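{- There is an absolute constant $C>0$ such that the following holds. For all odd integers $n\ge 11$ and all integers $H\ge 1$, $$ \#\mathcal{I}_n^+(H) \;\ge\; \frac{1}{n}\, H^{(n-1)^2/4} \;-\; C\, H^{(n-1)^2/4 - (n-9)/(n-5)}. $$ That is, $\#\mathcal{I}_n^+(H) \ge \frac{1}{n} H^{(n-1)^2/4} + O\big(H^{(n-1)^2/4 - (n-9)/(n-5)}\big)$ as $H\to\infty$, where $n$ is not assumed fixed and the implied constant in the $O$-symbol is absolute.
   Context: For positive integers $n$ and $H$, let $\mathcal{M}_n^+(\mathbb{Z};H)$ denote the set of $n\times n$ matrices $A=(a_{ij})$ with integer entries $a_{ij}\in\{0,1,\ldots,H\}$. Let $\mathcal{I}_n^+(H)$ denote the set of distinct polynomials $f\in\mathbb{Z}[X]$ that are irreducible over $\mathbb{Q}$ and occur as the characteristic polynomial $\det(XI_n - A)$ of some matrix $A\in\mathcal{M}_n^+(\mathbb{Z};H)$. -}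

module Defs where

open import Data.Nat as ℕ using (ℕ; zero; suc; _≤_; _<_)
open import Data.Integer as ℤ using (ℤ)
open import Data.Rational as ℚ using (ℚ)
open import Data.Fin using (Fin; toℕ; punchIn)
import Data.Fin as Fin
open import Data.List using (List; []; _∷_; map)
open import Data.Vec using (Vec; tabulate; toList)
open import Data.List.Membership.Propositional using (_∈_)
open import Data.List.Relation.Unary.Unique.Propositional using (Unique)
open import Data.Product using (Σ; ∃; _×_; _,_)
open import Data.Sum using (_⊎_)
open import Function.Bundles using (_⇔_)
open import Relation.Binary.PropositionalEquality using (_≡_)
open import Relation.Nullary using (yes; no)
open import Data.Empty using (⊥)

-- Polynomials as little-endian coefficient lists over a ring
-- (generic over the ring operations; used for ℤ and ℚ).

module Poly {A : Set} (0# 1# : A) (_+_ _*_ : A → A → A) (-_ : A → A) where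

  coeff : List A → ℕ → A
  coeff []       _       = 0#
  coeff (a ∷ p)  zero    = a
  coeff (a ∷ p)  (suc i) = coeff p i

  padd : List A → List A → List A
  padd []      q       = q
  padd p       []      = p
  padd (a ∷ p) (b ∷ q) = (a + b) ∷ padd p q

  pscale : A → List A → List A
  pscale c = map (c *_)

  pneg : List A → List A
  pneg = map -_

  pmul : List A → List A → List A
  pmul []      q = []
  pmul (a ∷ p) q = padd (pscale a q) (0# ∷ pmul p q)

  det : (n : ℕ) → (Fin n → Fin n → List A) → List A
  det zero    M = 1# ∷ []
  det (suc n) M = go (suc n) (λ j → j)
    where
    term : Fin (suc n) → List A
    term j = pmul (M Fin.zero j) (det n (λ r c → M (Fin.suc r) (punchIn j c)))
    signed : ℕ → List A → List A
    signed k p with k ℕ.% 2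
    ... | zero = p
    ... | _    = pneg p
    go : (m : ℕ) → (Fin m → Fin (suc n)) → List A
    go zero    f = []
    go (suc m) f = padd (signed (toℕ (f Fin.zero)) (term (f Fin.zero)))
                        (go m (λ i → f (Fin.suc i)))

open Poly (ℤ.+ 0) (ℤ.+ 1) ℤ._+_ ℤ._*_ ℤ.-_ public
  renaming (coeff to coeffℤ; det to detℤ; padd to paddℤ; pmul to pmulℤ;
            pscale to pscaleℤ; pneg to pnegℤ)
open Poly (ℚ.0ℚ) (ℚ.1ℚ) ℚ._+_ ℚ._*_ ℚ.-_ public
  renaming (coeff to coeffℚ; det to detℚ; padd to paddℚ; pmul to pmulℚ;
            pscale to pscaleℚ; pneg to pnegℚ)

charMat : (n : ℕ) → (Fin n → Fin n → ℕ) → Fin n → Fin n → List ℤ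
charMat n A i j with i Fin.≟ j
... | yes _ = ℤ.- (ℤ.+ A i j) ∷ ℤ.+ 1 ∷ []
... | no  _ = ℤ.- (ℤ.+ A i j) ∷ []

charPoly : (n : ℕ) → (Fin n → Fin n → ℕ) → Vec ℤ (suc n)
charPoly n A = tabulate (λ i → coeffℤ (detℤ n (charMat n A)) (toℕ i))

InBox : (n H : ℕ) → (Fin n → Fin n → ℕ) → Set
InBox n H A = ∀ i j → A i j ≤ H

_≈ℚ_ : List ℚ → List ℚ → Set
p ≈ℚ q = ∀ i → coeffℚ p i ≡ coeffℚ q i

IsConstℚ : List ℚ → Set
IsConstℚ p = ∀ i → 1 ≤ i → coeffℚ p i ≡ ℚ.0ℚ

-- f is irreducible in ℚ[X]: f is non-constant (so neither zero nor a unit),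
-- and in every factorisation f = g h one factor is a unit (a nonzero constant;
-- nonzero is automatic since f ≠ 0).
IrreducibleQ : List ℚ → Set
IrreducibleQ f =
  (IsConstℚ f → ⊥) ×
  (∀ g h → f ≈ℚ pmulℚ g h → IsConstℚ g ⊎ IsConstℚ h)

toℚPoly : {m : ℕ} → Vec ℤ m → List ℚ
toℚPoly v = map (λ z → z ℚ./ 1) (toList v)

InI : (n H : ℕ) → Vec ℤ (suc n) → Set
InI n H f = IrreducibleQ (toℚPoly f) ×
            Σ (Fin n → Fin n → ℕ) (λ A → InBox n H A × charPoly n A ≡ f)

-- L is a duplicate-free list enumerating exactly I_n^+(H);
-- its length is then #I_n^+(H).
Enumerates-I : (n H : ℕ) → List (Vec ℤ (suc n)) → Set
Enumerates-I n H L = Unique L × (∀ f → (f ∈ L) ⇔ InI n H f)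

{-# OPTIONS --safe #-}
module Submission where

-- Write n = 2m + 1.  With C = 1 the bound is trivial for H ≤ n, so let H > n and let W be the odd
-- number among H − 1 and H.  Take the lower Hessenberg matrix with superdiagonal
-- W, …, W, 2, 1, …, 1 (m − 1 entries W, m entries 1), entries d(p, k) < W in the rows p ≥ m and
-- columns k < m (numbered from 0), and zeros elsewhere.  Its characteristic polynomial is
--   X^n − 2 Σ_{k<m} W^{m−1−k} X^k Σ_{q≤m} d(2m − q, k) X^q.
-- The coefficients of the sum are written in base W with the d(p, k) as digits, so the
-- characteristic polynomials are pairwise distinct.  If d(2m, 0) = 1 the constant coefficient is
-- −2 W^{m−1}, and Eisenstein's criterion at 2 applies.  The m(m + 1) − 1 digits that remain free
-- give W^{m(m+1)−1} ≥ H^{m²} irreducible polynomials, which is more than the theorem claims.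

open import Defs
open import Algebra.Structures using (IsCommutativeRing)
import Algebra.Properties.AbelianGroup as AbelianGroupProperties
open import Data.Empty using (⊥; ⊥-elim)
open import Data.Fin as Fin using (Fin; zero; suc; toℕ; punchIn)
import Data.Fin.Properties as Fin
open import Data.Integer as ℤ using (ℤ; +_)
open import Data.Integer.Divisibility.Signed
  using (_∣_; divides; _∣?_; ∣ᵤ⇒∣; ∣⇒∣ᵤ; ∣-trans; ∣m∣n⇒∣m+n; ∣m+n∣m⇒∣n; ∣m+n∣n⇒∣m; ∣m⇒∣m*n; ∣n⇒∣m*n; ∣m⇒∣-m;
         *-cancelˡ-∣; *-monoʳ-∣; *-monoˡ-∣)
import Data.Integer.Properties as ℤ
import Data.Integer.Solver as ℤ-Solver
open import Data.List as List using (List; []; _∷_; map; length)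
open import Data.List.Membership.Propositional using (_∈_)
import Data.List.Relation.Unary.Any as Any
open import Data.List.Relation.Unary.Any.Properties using (lookup-index)
open import Data.Nat as ℕ using (ℕ; zero; suc; z≤n; s≤s; NonZero; _≤_; _<_; _*_; _∸_; _^_; _%_; _/_)
import Data.Nat.Divisibility as ℕ
import Data.Nat.DivMod as ℕ
open import Data.Nat.Induction using (<-wellFounded; Acc; acc)
open import Data.Nat.Primality using (Prime; prime?; euclidsLemma; prime⇒nonZero; prime⇒nonTrivial)
import Data.Nat.Properties as ℕ
import Data.Nat.Solver as ℕ-Solver
open import Data.Product using (Σ; ∃; ∃₂; _×_; _,_; proj₁; proj₂)
open import Data.Rational as ℚ using (ℚ; ↥_; ↧_; ↧ₙ_)
import Data.Rational.Properties as ℚ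
open import Data.Rational.Unnormalised as ℚᵘ using (mkℚᵘ; *≡*)
import Data.Rational.Unnormalised.Properties as ℚᵘ
open import Data.Sum as Sum using (_⊎_; inj₁; inj₂; [_,_]′)
open import Data.Vec using (Vec; []; _∷_; tabulate; toList)
open import Function using (_∘_; Injective)
open import Function.Bundles using (Equivalence)
open import Relation.Binary.PropositionalEquality
open import Relation.Nullary using (¬_; yes; no; contradiction)
open import Relation.Nullary.Decidable using (from-yes)

-- Polynomial coefficients and Hessenberg determinants

module PolyCoeff {A : Set} {_+_ _*_ : A → A → A} { -_ : A → A} {0# 1# : A}
                 (isCommutativeRing : IsCommutativeRing _≡_ _+_ _*_ -_ 0# 1#) where

  open ≡-Reasoning
  open IsCommutativeRing isCommutativeRing
    using (+-identityˡ; +-identityʳ; +-assoc; zeroˡ; zeroʳ; *-identityˡ; *-identityʳ; -‿inverseˡ)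
  open Poly 0# 1# _+_ _*_ -_

  private
    -0#≡0# : - 0# ≡ 0#
    -0#≡0# = trans (sym (+-identityʳ (- 0#))) (-‿inverseˡ 0#)

  coeff-padd : ∀ p q i → coeff (padd p q) i ≡ coeff p i + coeff q i
  coeff-padd []      q       i       = sym (+-identityˡ _)
  coeff-padd (a ∷ p) []      i       = sym (+-identityʳ _)
  coeff-padd (a ∷ p) (b ∷ q) zero    = refl
  coeff-padd (a ∷ p) (b ∷ q) (suc i) = coeff-padd p q i

  coeff-pneg : ∀ p i → coeff (pneg p) i ≡ - coeff p i
  coeff-pneg []      i       = sym -0#≡0#
  coeff-pneg (a ∷ p) zero    = refl
  coeff-pneg (a ∷ p) (suc i) = coeff-pneg p i

  coeff-pscale : ∀ a p i → coeff (pscale a p) i ≡ a * coeff p i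
  coeff-pscale a []      i       = sym (zeroʳ a)
  coeff-pscale a (b ∷ p) zero    = refl
  coeff-pscale a (b ∷ p) (suc i) = coeff-pscale a p i

  infixl 7 _⋆_
  -- The Cauchy product of coefficient sequences. The recursion strips the constant term of the
  -- first factor, as `pmul` does; working with sequences avoids trailing zeros of lists.
  _⋆_ : (ℕ → A) → (ℕ → A) → ℕ → A
  (f ⋆ g) zero    = f 0 * g 0
  (f ⋆ g) (suc k) = (f 0 * g (suc k)) + ((f ∘ suc) ⋆ g) k

  ⋆-cong : ∀ {f f′ g g′} → f ≗ f′ → g ≗ g′ → f ⋆ g ≗ f′ ⋆ g′
  ⋆-cong f≗ g≗ zero    = cong₂ _*_ (f≗ 0) (g≗ 0)
  ⋆-cong f≗ g≗ (suc k) = cong₂ _+_ (cong₂ _*_ (f≗ 0) (g≗ (suc k))) (⋆-cong (f≗ ∘ suc) g≗ k)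

  ⋆-zeroˡ : ∀ {f} g → (∀ i → f i ≡ 0#) → ∀ k → (f ⋆ g) k ≡ 0#
  ⋆-zeroˡ g f≡0 zero    = trans (cong (_* g 0) (f≡0 0)) (zeroˡ _)
  ⋆-zeroˡ g f≡0 (suc k) = trans
    (cong₂ _+_ (trans (cong (_* g (suc k)) (f≡0 0)) (zeroˡ _)) (⋆-zeroˡ g (f≡0 ∘ suc) k))
    (+-identityˡ 0#)

  ⋆-constˡ : ∀ {f} g → (∀ i → f (suc i) ≡ 0#) → ∀ k → (f ⋆ g) k ≡ f 0 * g k
  ⋆-constˡ g f≡0 zero    = refl
  ⋆-constˡ g f≡0 (suc k) = trans (cong (_+_ _) (⋆-zeroˡ g f≡0 k)) (+-identityʳ _)

  shift : (ℕ → A) → ℕ → A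
  shift f zero    = 0#
  shift f (suc i) = f i

  ⋆-Xˡ : ∀ {f} g → f ≗ coeff (0# ∷ 1# ∷ []) → f ⋆ g ≗ shift g
  ⋆-Xˡ g f≗X zero    = trans (cong (_* g 0) (f≗X 0)) (zeroˡ _)
  ⋆-Xˡ {f} g f≗X (suc k) = begin
    (f 0 * g (suc k)) + ((f ∘ suc) ⋆ g) k
      ≡⟨ cong₂ _+_ (trans (cong (_* g (suc k)) (f≗X 0)) (zeroˡ _)) (⋆-constˡ g (λ i → f≗X (suc (suc i))) k) ⟩
    0# + (f 1 * g k)  ≡⟨ +-identityˡ _ ⟩
    f 1 * g k         ≡⟨ cong (_* g k) (f≗X 1) ⟩
    1# * g k          ≡⟨ *-identityˡ _ ⟩
    g k               ∎

  -- The counterpart of the defining equation that strips the constant term of the second factor.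
  -- Inductions on the second factor and commutativity rest on it.
  ⋆-sucʳ : ∀ f g k → (f ⋆ g) (suc k) ≡ (f ⋆ (g ∘ suc)) k + (f (suc k) * g 0)
  ⋆-sucʳ f g zero    = refl
  ⋆-sucʳ f g (suc k) = trans (cong (_+_ _) (⋆-sucʳ (f ∘ suc) g k)) (sym (+-assoc _ _ _))

  coeff-pmul : ∀ p q → coeff (pmul p q) ≗ coeff p ⋆ coeff q
  coeff-pmul []      q k       = sym (⋆-zeroˡ (coeff q) (λ _ → refl) k)
  coeff-pmul (a ∷ p) q zero    = trans (coeff-padd (pscale a q) _ 0)
    (trans (+-identityʳ _) (coeff-pscale a q 0))
  coeff-pmul (a ∷ p) q (suc k) = trans (coeff-padd (pscale a q) _ (suc k))
    (cong₂ _+_ (coeff-pscale a q (suc k)) (coeff-pmul p q k))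

  -- IsZero and RowZero are records so that their arguments can be read off the type.
  record IsZero (p : List A) : Set where
    constructor isZero
    field at : ∀ i → coeff p i ≡ 0#
  open IsZero

  record RowZero {N m} (M : Fin (suc N) → Fin (suc N) → List A) (cols : Fin m → Fin (suc N)) : Set where
    constructor rowZero
    field entry : ∀ j → IsZero (M zero (cols j))
  open RowZero

  pmul-zeroˡ : ∀ p q → IsZero p → IsZero (pmul p q)
  pmul-zeroˡ p q z = isZero λ i → trans (coeff-pmul p q i) (⋆-zeroˡ (coeff q) (at z) i)

  pneg-zero : ∀ p → IsZero p → IsZero (pneg p)
  pneg-zero p z = isZero λ i → trans (coeff-pneg p i) (trans (cong -_ (at z i)) -0#≡0#)

  padd-zero : ∀ p q → IsZero p → IsZero q → IsZero (padd p q)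
  padd-zero p q zp zq = isZero λ i →
    trans (coeff-padd p q i) (trans (cong₂ _+_ (at zp i) (at zq i)) (+-identityˡ 0#))

  minor : ∀ {n} → (Fin (suc n) → Fin (suc n) → List A) → Fin (suc n) → Fin n → Fin n → List A
  minor M j r c = M (suc r) (punchIn j c)

  -- The local function `go` of `det` has no name in scope: the underscores below are solved
  -- to its applications.  The with-abstraction in tail₂-zero turns the arguments of `go` into
  -- distinct variables, which is what lets the underscore of tail-zero be solved.
  mutual
    private
      tail-zero : ∀ N (M : Fin (suc N) → Fin (suc N) → List A) m (cols : Fin m → Fin (suc N)) →
                  RowZero M cols → IsZero _

      tail₂-zero : ∀ n (M : Fin (suc (suc n)) → Fin (suc (suc n)) → List A) →
                   RowZero M (λ (j : Fin n) → suc (suc j)) → IsZero _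

    det-two-terms : ∀ n (M : Fin (suc (suc n)) → Fin (suc (suc n)) → List A) →
                    (∀ j → IsZero (M zero (suc (suc j)))) → ∀ i →
                    coeff (det (suc (suc n)) M) i ≡
                      coeff (pmul (M zero zero) (det (suc n) (minor M zero))) i +
                      (- coeff (pmul (M zero (suc zero)) (det (suc n) (minor M (suc zero)))) i)
    det-two-terms n M row i = split
      (pmul (M zero zero) (det (suc n) (minor M zero)))
      (pmul (M zero (suc zero)) (det (suc n) (minor M (suc zero)))) _
      (tail₂-zero n M (rowZero row))
      where
      split : ∀ a b r → IsZero r →
              coeff (padd a (padd (pneg b) r)) i ≡ coeff a i + (- coeff b i)
      split a b r z = trans (coeff-padd a _ i) (cong (_+_ (coeff a i))
        (trans (coeff-padd (pneg b) r i)
          (trans (cong₂ _+_ (coeff-pneg b i) (at z i)) (+-identityʳ _))))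

    tail₂-zero n M row with suc n | M | (λ (j : Fin n) → Fin.suc (Fin.suc j)) | row
    ... | N | M′ | cols | row′ = tail-zero N M′ n cols row′

    tail-zero N M zero    cols row = isZero λ i → refl
    tail-zero N M (suc m) cols row with toℕ (cols zero) % 2
    ... | zero  = padd-zero (pmul (M zero (cols zero)) _) _ (pmul-zeroˡ _ _ (entry row zero))
                    (tail-zero N M m (λ j → cols (suc j)) (rowZero λ j → entry row (suc j)))
    ... | suc _ = padd-zero _ _ (pneg-zero (pmul (M zero (cols zero)) _) (pmul-zeroˡ _ _ (entry row zero)))
                    (tail-zero N M m (λ j → cols (suc j)) (rowZero λ j → entry row (suc j)))

  det-one : ∀ M → coeff (det 1 M) ≗ coeff (M zero zero)
  det-one M i = begin
    coeff (det 1 M) i                          ≡⟨ coeff-padd (pmul (M zero zero) _) [] i ⟩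
    coeff (pmul (M zero zero) _) i + 0#        ≡⟨ +-identityʳ _ ⟩
    coeff (pmul (M zero zero) (1# ∷ [])) i     ≡⟨ coeff-pmul (M zero zero) _ i ⟩
    (coeff (M zero zero) ⋆ coeff (1# ∷ [])) i  ≡⟨ mul-one (coeff (M zero zero)) i ⟩
    coeff (M zero zero) i                      ∎
    where
    mul-one : ∀ f → f ⋆ coeff (1# ∷ []) ≗ f
    mul-one f zero    = *-identityʳ _
    mul-one f (suc i) = trans (cong₂ _+_ (zeroʳ _) (mul-one (f ∘ suc) i)) (+-identityˡ _)

  -- The determinant of the lower Hessenberg matrix on rows and columns k … k + s of E, with
  -- column k replaced by c; rows of c are numbered as those of E.
  hessDet : (ℕ → ℕ → ℕ → A) → ℕ → ℕ → (ℕ → ℕ → A) → ℕ → A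
  hessDet E k zero    c = c k
  hessDet E k (suc s) c i =
    (c k ⋆ hessDet E (suc k) s (λ r → E r (suc k))) i +
    (- (E k (suc k) ⋆ hessDet E (suc k) s c) i)

  -- Expansion along the first row leaves two minors. Deleting column 0 gives the next trailing
  -- block of `E`; deleting column 1 gives the same block with its first column still taken from
  -- `c`. The second minor is why the statement allows an arbitrary first column.
  det-hessenberg : ∀ {E} → (∀ r j i → E r (suc (suc (r ℕ.+ j))) i ≡ 0#) →
    ∀ k s c (M : Fin (suc s) → Fin (suc s) → List A) →
    (∀ r → coeff (M r zero) ≗ c (k ℕ.+ toℕ r)) →
    (∀ r j → coeff (M r (suc j)) ≗ E (k ℕ.+ toℕ r) (k ℕ.+ suc (toℕ j))) →
    coeff (det (suc s) M) ≗ hessDet E k s c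
  det-hessenberg E≡0 k zero c M first rest i =
    trans (det-one M i) (trans (first zero i) (cong (λ x → c x i) (ℕ.+-identityʳ k)))
  det-hessenberg {E} E≡0 k (suc s) c M first rest i = begin
    coeff (det (suc (suc s)) M) i
      ≡⟨ det-two-terms s M (λ j → isZero λ t → trans (rest zero (suc j) t)
           (trans (cong₂ (λ x y → E x y t) (ℕ.+-identityʳ k)
             (trans (ℕ.+-suc k (suc (toℕ j))) (cong suc (ℕ.+-suc k (toℕ j))))) (E≡0 k (toℕ j) t))) i ⟩
    coeff (pmul (M zero zero) (det (suc s) (minor M zero))) i +
    (- coeff (pmul (M zero (suc zero)) (det (suc s) (minor M (suc zero)))) i)
      ≡⟨ cong₂ (λ x y → x + (- y))
           (trans (coeff-pmul (M zero zero) _ i) (⋆-cong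
             (λ t → trans (first zero t) (cong (λ x → c x t) (ℕ.+-identityʳ k)))
             (det-hessenberg E≡0 (suc k) s (λ r → E r (suc k)) (minor M zero) first′ rest′) i))
           (trans (coeff-pmul (M zero (suc zero)) _ i) (⋆-cong
             (λ t → trans (rest zero zero t)
                (cong₂ (λ x y → E x y t) (ℕ.+-identityʳ k) (trans (ℕ.+-suc k 0) (cong suc (ℕ.+-identityʳ k)))))
             (det-hessenberg E≡0 (suc k) s c (minor M (suc zero)) first″ rest′) i)) ⟩
    hessDet E k (suc s) c i ∎
    where
    first′ : ∀ r → coeff (M (suc r) (suc zero)) ≗ E (suc k ℕ.+ toℕ r) (suc k)
    first′ r t = trans (rest (suc r) zero t) (cong₂ (λ x y → E x y t) (ℕ.+-suc k (toℕ r))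
      (trans (ℕ.+-suc k 0) (cong suc (ℕ.+-identityʳ k))))
    first″ : ∀ r → coeff (M (suc r) zero) ≗ c (suc k ℕ.+ toℕ r)
    first″ r t = trans (first (suc r) t) (cong (λ x → c x t) (ℕ.+-suc k (toℕ r)))
    rest′ : ∀ r j → coeff (M (suc r) (suc (suc j))) ≗ E (suc k ℕ.+ toℕ r) (suc k ℕ.+ suc (toℕ j))
    rest′ r j t = trans (rest (suc r) (suc j) t)
      (cong₂ (λ x y → E x y t) (ℕ.+-suc k (toℕ r)) (ℕ.+-suc k (suc (toℕ j))))

open PolyCoeff ℤ.+-*-isCommutativeRing
module PolyCoeffℚ = PolyCoeff ℚ.+-*-isCommutativeRing

-- Clearing denominators

ι : ℤ → ℚ
ι x = x ℚ./ 1

toℚᵘ-ι : ∀ x → ℚ.toℚᵘ (ι x) ℚᵘ.≃ mkℚᵘ x 0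
toℚᵘ-ι x = ℚ.toℚᵘ-fromℚᵘ (mkℚᵘ x 0)

ι-injective : ∀ {x y} → ι x ≡ ι y → x ≡ y
ι-injective {x} {y} eq with ℚ.fromℚᵘ-injective {mkℚᵘ x 0} {mkℚᵘ y 0} eq
... | *≡* e = trans (sym (ℤ.*-identityʳ x)) (trans e (ℤ.*-identityʳ y))

ι-homo-+ : ∀ x y → ι (x ℤ.+ y) ≡ ι x ℚ.+ ι y
ι-homo-+ x y = ℚ.toℚᵘ-injective (begin
  ℚ.toℚᵘ (ι (x ℤ.+ y))            ≈⟨ toℚᵘ-ι (x ℤ.+ y) ⟩
  mkℚᵘ (x ℤ.+ y) 0                ≈⟨ *≡* (cong₂ (λ a b → (a ℤ.+ b) ℤ.* + 1) (sym (ℤ.*-identityʳ x)) (sym (ℤ.*-identityʳ y))) ⟩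
  mkℚᵘ x 0 ℚᵘ.+ mkℚᵘ y 0          ≈⟨ ℚᵘ.+-cong (toℚᵘ-ι x) (toℚᵘ-ι y) ⟨
  ℚ.toℚᵘ (ι x) ℚᵘ.+ ℚ.toℚᵘ (ι y)  ≈⟨ ℚ.toℚᵘ-homo-+ (ι x) (ι y) ⟨
  ℚ.toℚᵘ (ι x ℚ.+ ι y)            ∎)
  where open ℚᵘ.≃-Reasoning

ι-homo-* : ∀ x y → ι (x ℤ.* y) ≡ ι x ℚ.* ι y
ι-homo-* x y = ℚ.toℚᵘ-injective (begin
  ℚ.toℚᵘ (ι (x ℤ.* y))            ≈⟨ toℚᵘ-ι (x ℤ.* y) ⟩
  mkℚᵘ x 0 ℚᵘ.* mkℚᵘ y 0          ≈⟨ ℚᵘ.*-cong (toℚᵘ-ι x) (toℚᵘ-ι y) ⟨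
  ℚ.toℚᵘ (ι x) ℚᵘ.* ℚ.toℚᵘ (ι y)  ≈⟨ ℚ.toℚᵘ-homo-* (ι x) (ι y) ⟨
  ℚ.toℚᵘ (ι x ℚ.* ι y)            ∎)
  where open ℚᵘ.≃-Reasoning

↧*≡↥ : ∀ a → ι (↧ a) ℚ.* a ≡ ι (↥ a)
↧*≡↥ a@(ℚ.mkℚ n d _) = ℚ.toℚᵘ-injective (begin
  ℚ.toℚᵘ (ι (↧ a) ℚ.* a)          ≈⟨ ℚ.toℚᵘ-homo-* (ι (↧ a)) a ⟩
  ℚ.toℚᵘ (ι (↧ a)) ℚᵘ.* mkℚᵘ n d  ≈⟨ ℚᵘ.*-cong (toℚᵘ-ι (↧ a)) (ℚᵘ.≃-refl {mkℚᵘ n d}) ⟩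
  mkℚᵘ (↧ a) 0 ℚᵘ.* mkℚᵘ n d      ≈⟨ *≡* (solve 2 (λ x y → x :* y :* con (+ 1) := y :* (con (+ 1) :* x)) refl (↧ a) n) ⟩
  mkℚᵘ n 0                        ≈⟨ toℚᵘ-ι n ⟨
  ℚ.toℚᵘ (ι n)                    ∎)
  where
  open ℚᵘ.≃-Reasoning
  open ℤ-Solver.+-*-Solver

_IsMultipleOf_By_ : List ℤ → List ℚ → ℕ → Set
G IsMultipleOf g By D = ∀ i → ι (coeffℤ G i) ≡ ι (+ D) ℚ.* coeffℚ g i

-- `D` is the product of all denominators; nothing finer than a nonzero common multiple is wanted.
clear-denominators : ∀ g → ∃₂ λ D G → NonZero D × G IsMultipleOf g By D
clear-denominators []      = 1 , [] , _ , λ i → refl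
clear-denominators (a ∷ g) with clear-denominators g
... | D , G , D≢0 , eq = ↧ₙ a * D , (↥ a ℤ.* + D) ∷ pscaleℤ (↧ a) G , ℕ.m*n≢0 (↧ₙ a) D {{_}} {{D≢0}} , eq′
  where
  open ≡-Reasoning
  instance
    _ = D≢0
  *-ι : ι (+ (↧ₙ a * D)) ≡ ι (↧ a) ℚ.* ι (+ D)
  *-ι = trans (cong ι (ℤ.pos-* (↧ₙ a) D)) (ι-homo-* (↧ a) (+ D))
  eq′ : ((↥ a ℤ.* + D) ∷ pscaleℤ (↧ a) G) IsMultipleOf (a ∷ g) By (↧ₙ a * D)
  eq′ zero = begin
    ι (↥ a ℤ.* + D)              ≡⟨ ι-homo-* (↥ a) (+ D) ⟩
    ι (↥ a) ℚ.* ι (+ D)          ≡⟨ cong (ℚ._* ι (+ D)) (↧*≡↥ a) ⟨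
    (ι (↧ a) ℚ.* a) ℚ.* ι (+ D)  ≡⟨ ℚ.*-assoc (ι (↧ a)) a (ι (+ D)) ⟩
    ι (↧ a) ℚ.* (a ℚ.* ι (+ D))  ≡⟨ cong (ι (↧ a) ℚ.*_) (ℚ.*-comm a (ι (+ D))) ⟩
    ι (↧ a) ℚ.* (ι (+ D) ℚ.* a)  ≡⟨ ℚ.*-assoc (ι (↧ a)) (ι (+ D)) a ⟨
    (ι (↧ a) ℚ.* ι (+ D)) ℚ.* a  ≡⟨ cong (ℚ._* a) *-ι ⟨
    ι (+ (↧ₙ a * D)) ℚ.* a       ∎
  eq′ (suc i) = begin
    ι (coeffℤ (pscaleℤ (↧ a) G) i)        ≡⟨ cong ι (coeff-pscale (↧ a) G i) ⟩
    ι (↧ a ℤ.* coeffℤ G i)                ≡⟨ ι-homo-* (↧ a) (coeffℤ G i) ⟩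
    ι (↧ a) ℚ.* ι (coeffℤ G i)            ≡⟨ cong (ι (↧ a) ℚ.*_) (eq i) ⟩
    ι (↧ a) ℚ.* (ι (+ D) ℚ.* coeffℚ g i)  ≡⟨ ℚ.*-assoc (ι (↧ a)) (ι (+ D)) (coeffℚ g i) ⟨
    (ι (↧ a) ℚ.* ι (+ D)) ℚ.* coeffℚ g i  ≡⟨ cong (ℚ._* coeffℚ g i) *-ι ⟨
    ι (+ (↧ₙ a * D)) ℚ.* coeffℚ g i       ∎

-- Bilinearity of the product: if denominators are cleared in each factor separately, the product is
-- scaled by `a` times `b`.
⋆-ι : ∀ a b {F G} f g → (∀ i → ι (F i) ≡ a ℚ.* f i) → (∀ i → ι (G i) ≡ b ℚ.* g i) →
       ∀ k → ι ((F ⋆ G) k) ≡ (a ℚ.* b) ℚ.* (f PolyCoeffℚ.⋆ g) k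
⋆-ι a b {F} {G} f g F≡ G≡ = go
  where
  open ≡-Reasoning
  product : ∀ i j → ι (F i ℤ.* G j) ≡ (a ℚ.* b) ℚ.* (f i ℚ.* g j)
  product i j = begin
    ι (F i ℤ.* G j)              ≡⟨ ι-homo-* (F i) (G j) ⟩
    ι (F i) ℚ.* ι (G j)          ≡⟨ cong₂ ℚ._*_ (F≡ i) (G≡ j) ⟩
    (a ℚ.* f i) ℚ.* (b ℚ.* g j)  ≡⟨ ℚ.*-assoc a (f i) (b ℚ.* g j) ⟩
    a ℚ.* (f i ℚ.* (b ℚ.* g j))  ≡⟨ cong (a ℚ.*_) (ℚ.*-assoc (f i) b (g j)) ⟨
    a ℚ.* ((f i ℚ.* b) ℚ.* g j)  ≡⟨ cong (λ x → a ℚ.* (x ℚ.* g j)) (ℚ.*-comm (f i) b) ⟩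
    a ℚ.* ((b ℚ.* f i) ℚ.* g j)  ≡⟨ cong (a ℚ.*_) (ℚ.*-assoc b (f i) (g j)) ⟩
    a ℚ.* (b ℚ.* (f i ℚ.* g j))  ≡⟨ ℚ.*-assoc a b (f i ℚ.* g j) ⟨
    (a ℚ.* b) ℚ.* (f i ℚ.* g j)  ∎
  go : ∀ k → ι ((F ⋆ G) k) ≡ (a ℚ.* b) ℚ.* (f PolyCoeffℚ.⋆ g) k
  go zero    = product 0 0
  go (suc k) = begin
    ι (F 0 ℤ.* G (suc k) ℤ.+ ((F ∘ suc) ⋆ G) k)
      ≡⟨ ι-homo-+ (F 0 ℤ.* G (suc k)) (((F ∘ suc) ⋆ G) k) ⟩
    ι (F 0 ℤ.* G (suc k)) ℚ.+ ι (((F ∘ suc) ⋆ G) k)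
      ≡⟨ cong₂ ℚ._+_ (product 0 (suc k)) (⋆-ι a b (f ∘ suc) g (F≡ ∘ suc) G≡ k) ⟩
    (a ℚ.* b) ℚ.* (f 0 ℚ.* g (suc k)) ℚ.+ (a ℚ.* b) ℚ.* ((f ∘ suc) PolyCoeffℚ.⋆ g) k
      ≡⟨ ℚ.*-distribˡ-+ (a ℚ.* b) (f 0 ℚ.* g (suc k)) (((f ∘ suc) PolyCoeffℚ.⋆ g) k) ⟨
    (a ℚ.* b) ℚ.* (f PolyCoeffℚ.⋆ g) (suc k) ∎

-- Eisenstein's criterion

-- In coefficient `s + t` of the product every term other than `f s * g t` has a factor `f i` with
-- `i < s` or `g j` with `j < t`, so it vanishes modulo `q`. The induction strips these low
-- coefficients one at a time.
⋆-low : ∀ {q} f g s t → (∀ i → i < s → q ∣ f i) → (∀ j → j < t → q ∣ g j) →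
        q ∣ (f ⋆ g) (s ℕ.+ t) → q ∣ f s ℤ.* g t
⋆-low f g zero    zero    q∣f q∣g h = h
⋆-low f g zero    (suc t) q∣f q∣g h = ⋆-low f (g ∘ suc) zero t q∣f (λ j j<t → q∣g (suc j) (s≤s j<t))
  (∣m+n∣n⇒∣m {m = (f ⋆ (g ∘ suc)) t} (subst (_ ∣_) (⋆-sucʳ f g t) h) (∣n⇒∣m*n (f (suc t)) (q∣g 0 (s≤s z≤n))))
⋆-low f g (suc s) t       q∣f q∣g h = ⋆-low (f ∘ suc) g s t (λ i i<s → q∣f (suc i) (s≤s i<s)) q∣g
  (∣m+n∣m⇒∣n {m = f 0 ℤ.* g (suc (s ℕ.+ t))} h (∣m⇒∣m*n (g (suc (s ℕ.+ t))) (q∣f 0 (s≤s z≤n))))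

-- The mirror image of `⋆-low` at the upper end: the leading coefficient of a product is the product
-- of the leading coefficients.
⋆-top : ∀ f g s t → (∀ i → s < i → f i ≡ + 0) → (∀ j → t < j → g j ≡ + 0) →
        (f ⋆ g) (s ℕ.+ t) ≡ f s ℤ.* g t
⋆-top f g zero    t f≡0 g≡0 = ⋆-constˡ g (λ i → f≡0 (suc i) (s≤s z≤n)) t
⋆-top f g (suc s) t f≡0 g≡0 = trans
  (cong₂ ℤ._+_ (trans (cong (f 0 ℤ.*_) (g≡0 (suc (s ℕ.+ t)) (s≤s (ℕ.m≤n+m t s)))) (ℤ.*-zeroʳ (f 0)))
    (⋆-top (f ∘ suc) g s t (λ i s<i → f≡0 (suc i) (s≤s s<i)) g≡0))
  (ℤ.+-identityˡ _)

⋆-∣ʳ : ∀ {q} f g → (∀ j → q ∣ g j) → ∀ k → q ∣ (f ⋆ g) k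
⋆-∣ʳ f g q∣g zero    = ∣n⇒∣m*n (f 0) (q∣g 0)
⋆-∣ʳ f g q∣g (suc k) = ∣m∣n⇒∣m+n (∣n⇒∣m*n (f 0) (q∣g (suc k))) (⋆-∣ʳ (f ∘ suc) g q∣g k)

⋆-comm : ∀ f g → f ⋆ g ≗ g ⋆ f
⋆-comm f g zero    = ℤ.*-comm (f 0) (g 0)
⋆-comm f g (suc k) = trans
  (cong₂ ℤ._+_ (ℤ.*-comm (f 0) (g (suc k))) (⋆-comm (f ∘ suc) g k))
  (trans (ℤ.+-comm (g (suc k) ℤ.* f 0) ((g ⋆ (f ∘ suc)) k)) (sym (⋆-sucʳ g f k)))

∣-zero : ∀ {q} → q ∣ + 0
∣-zero {q} = divides (+ 0) refl

first-nondivisible : ∀ q G → (∀ i → q ∣ coeffℤ G i) ⊎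
  ∃ λ s → ¬ (q ∣ coeffℤ G s) × (∀ i → i < s → q ∣ coeffℤ G i)
first-nondivisible q []      = inj₁ λ i → ∣-zero
first-nondivisible q (a ∷ G) with q ∣? a
... | no  q∤a = inj₂ (0 , q∤a , λ i ())
... | yes q∣a with first-nondivisible q G
...   | inj₁ q∣G             = inj₁ λ { zero → q∣a ; (suc i) → q∣G i }
...   | inj₂ (s , q∤s , q∣<) = inj₂ (suc s , q∤s , λ { zero _ → q∣a ; (suc i) (s≤s i<s) → q∣< i i<s })

last-nonzero : ∀ G → (∀ i → coeffℤ G i ≡ + 0) ⊎
  ∃ λ s → coeffℤ G s ≢ + 0 × (∀ i → s < i → coeffℤ G i ≡ + 0)
last-nonzero []      = inj₁ λ i → refl
last-nonzero (a ∷ G) with last-nonzero G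
... | inj₂ (s , ≢0 , ≡0) = inj₂ (suc s , ≢0 , λ { (suc i) (s≤s s<i) → ≡0 i s<i })
... | inj₁ G≡0 with a ℤ.≟ + 0
...   | yes a≡0 = inj₁ λ { zero → a≡0 ; (suc i) → G≡0 i }
...   | no  a≢0 = inj₂ (0 , a≢0 , λ { (suc i) _ → G≡0 i })

divide-coeffs : ∀ q G → (∀ i → q ∣ coeffℤ G i) → ∃ λ G′ → ∀ i → coeffℤ G i ≡ q ℤ.* coeffℤ G′ i
divide-coeffs q []      q∣G = [] , λ i → sym (ℤ.*-zeroʳ q)
divide-coeffs q (a ∷ G) q∣G with q∣G 0 | divide-coeffs q G (q∣G ∘ suc)
... | divides b a≡bq | G′ , eq = b ∷ G′ , λ { zero → trans a≡bq (ℤ.*-comm b q) ; (suc i) → eq i }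

prime-∣* : ∀ {p} → Prime p → ∀ x y → + p ∣ x ℤ.* y → + p ∣ x ⊎ + p ∣ y
prime-∣* {p} pr x y p∣xy =
  Sum.map ∣ᵤ⇒∣ ∣ᵤ⇒∣ (euclidsLemma ℤ.∣ x ∣ ℤ.∣ y ∣ pr (subst (p ℕ.∣_) (ℤ.abs-* x y) (∣⇒∣ᵤ p∣xy)))

IsConstℤ : List ℤ → Set
IsConstℤ G = ∀ i → 1 ≤ i → coeffℤ G i ≡ + 0

-- If both factors had a coefficient prime to `p`, take the least such indices `s` and `t`. By
-- `⋆-low`, `p` would divide the product of these two coefficients.
gauss-lemma : ∀ {p} → Prime p → ∀ G H → (∀ k → + p ∣ (coeffℤ G ⋆ coeffℤ H) k) →
              (∀ i → + p ∣ coeffℤ G i) ⊎ (∀ i → + p ∣ coeffℤ H i)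
gauss-lemma {p} pr G H p∣GH with first-nondivisible (+ p) G | first-nondivisible (+ p) H
... | inj₁ p∣G | _ = inj₁ p∣G
... | inj₂ _ | inj₁ p∣H = inj₂ p∣H
... | inj₂ (s , p∤s , p∣<s) | inj₂ (t , p∤t , p∣<t) =
  contradiction (prime-∣* pr _ _ (⋆-low (coeffℤ G) (coeffℤ H) s t p∣<s p∣<t (p∣GH (s ℕ.+ t)))) [ p∤s , p∤t ]′

⋆-scaleˡ : ∀ {f f′} q g → (∀ i → f i ≡ q ℤ.* f′ i) → ∀ k → (f ⋆ g) k ≡ q ℤ.* (f′ ⋆ g) k
⋆-scaleˡ {f} {f′} q g f≡ zero = trans (cong (ℤ._* g 0) (f≡ 0)) (ℤ.*-assoc q (f′ 0) (g 0))
⋆-scaleˡ {f} {f′} q g f≡ (suc k) = trans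
  (cong₂ ℤ._+_ (trans (cong (ℤ._* g (suc k)) (f≡ 0)) (ℤ.*-assoc q (f′ 0) (g (suc k)))) (⋆-scaleˡ q g (f≡ ∘ suc) k))
  (sym (ℤ.*-distribˡ-+ q (f′ 0 ℤ.* g (suc k)) (((f′ ∘ suc) ⋆ g) k)))

⋆-scaleʳ : ∀ {g g′} q f → (∀ i → g i ≡ q ℤ.* g′ i) → ∀ k → (f ⋆ g) k ≡ q ℤ.* (f ⋆ g′) k
⋆-scaleʳ {g} {g′} q f g≡ = go
  where
  swap : ∀ x j → x ℤ.* g j ≡ q ℤ.* (x ℤ.* g′ j)
  swap x j = trans (cong (x ℤ.*_) (g≡ j))
    (solve 3 (λ x q y → x :* (q :* y) := q :* (x :* y)) refl x q (g′ j))
    where open ℤ-Solver.+-*-Solver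
  go : ∀ k → (f ⋆ g) k ≡ q ℤ.* (f ⋆ g′) k
  go zero    = swap (f 0) 0
  go (suc k) = trans (cong₂ ℤ._+_ (swap (f 0) (suc k)) (⋆-scaleʳ q (f ∘ suc) g≡ k))
    (sym (ℤ.*-distribˡ-+ q (f 0 ℤ.* g′ (suc k)) (((f ∘ suc) ⋆ g′) k)))

IsConstℤ-scale : ∀ q G G′ → (∀ i → coeffℤ G i ≡ q ℤ.* coeffℤ G′ i) → IsConstℤ G′ → IsConstℤ G
IsConstℤ-scale q G G′ eq c i 1≤i = trans (eq i) (trans (cong (q ℤ.*_) (c i 1≤i)) (ℤ.*-zeroʳ q))

record EisensteinAt (p n : ℕ) (f : ℕ → ℤ) : Set where
  field
    isPrime  : Prime p
    top∤     : ¬ (+ p ∣ f n)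
    lower∣   : ∀ i → i < n → + p ∣ f i
    const∤²  : ¬ (+ p ℤ.* + p ∣ f 0)
    above≡0  : ∀ i → n < i → f i ≡ + 0

module _ {p n f} (eis : EisensteinAt p n f) where
  open EisensteinAt eis

  private
    instance
      p≢0 : NonZero p
      p≢0 = prime⇒nonZero isPrime

    -- Let `t` be the least index at which `p` does not divide `H`. Coefficient `t` of the product
    -- is congruent to the constant term of `G` times coefficient `t` of `H`, so it is prime to `p`.
    -- As `p` divides `f i` for `i < n`, this forces `n ≤ t`, so `H` has degree at least `n`. If `G`
    -- had positive degree, the product would have degree above `n`.
    degree-argument : ∀ {N} → ¬ (+ p ∣ + N) → ∀ G H → ¬ (+ p ∣ coeffℤ G 0) → + p ∣ coeffℤ H 0 →
      (∀ k → (coeffℤ G ⋆ coeffℤ H) k ≡ + N ℤ.* f k) → IsConstℤ G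
    degree-argument {N} p∤N G H p∤G₀ p∣H₀ GH≡Nf
      with first-nondivisible (+ p) H | last-nonzero H | last-nonzero G
    ... | inj₁ p∣H | _ | _ =
      contradiction (prime-∣* isPrime (+ N) (f n) (subst (+ p ∣_) (GH≡Nf n) (⋆-∣ʳ (coeffℤ G) _ p∣H n)))
        [ p∤N , top∤ ]′
    ... | inj₂ (t , p∤t , _) | inj₁ H≡0 | _ = contradiction (subst (+ p ∣_) (sym (H≡0 t)) ∣-zero) p∤t
    ... | _ | _ | inj₁ G≡0 = λ i _ → G≡0 i
    ... | _ | _ | inj₂ (zero , _ , G≡0) = λ { (suc i) _ → G≡0 (suc i) (s≤s z≤n) }
    ... | inj₂ (t , p∤t , p∣<t) | inj₂ (u , Hu≢0 , H≡0) | inj₂ (suc s , Gs≢0 , G≡0) =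
      ⊥-elim ([ Gs≢0 , Hu≢0 ]′ (ℤ.i*j≡0⇒i≡0∨j≡0 (coeffℤ G (suc s)) (begin
        coeffℤ G (suc s) ℤ.* coeffℤ H u      ≡⟨ ⋆-top (coeffℤ G) (coeffℤ H) (suc s) u G≡0 H≡0 ⟨
        (coeffℤ G ⋆ coeffℤ H) (suc s ℕ.+ u)  ≡⟨ GH≡Nf (suc s ℕ.+ u) ⟩
        + N ℤ.* f (suc s ℕ.+ u)              ≡⟨ cong (+ N ℤ.*_) (above≡0 _ (s≤s (ℕ.≤-trans (ℕ.≤-trans n≤t t≤u) (ℕ.m≤n+m u s)))) ⟩
        + N ℤ.* + 0                          ≡⟨ ℤ.*-zeroʳ (+ N) ⟩
        + 0                                  ∎)))
      where
      open ≡-Reasoning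
      t≤u : t ≤ u
      t≤u with t ℕ.≤? u
      ... | yes le = le
      ... | no  nle = contradiction (subst (+ p ∣_) (sym (H≡0 t (ℕ.≰⇒> nle))) ∣-zero) p∤t
      p∤GHt : ¬ (+ p ∣ (coeffℤ G ⋆ coeffℤ H) t)
      p∤GHt h = [ p∤G₀ , p∤t ]′ (prime-∣* isPrime _ _ (⋆-low (coeffℤ G) (coeffℤ H) 0 t (λ i ()) p∣<t h))
      n≤t : n ≤ t
      n≤t with n ℕ.≤? t
      ... | yes le = le
      ... | no nle = contradiction
        (subst (+ p ∣_) (sym (GH≡Nf t)) (∣n⇒∣m*n (+ N) (lower∣ t (ℕ.≰⇒> nle)))) p∤GHt

    -- The product of the two constant terms is `N * f 0`, which `p` divides exactly once. Hence `p`
    -- divides exactly one of them, and the other factor is the constant one by `degree-argument`.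
    coprime-case : ∀ {N} → ¬ (+ p ∣ + N) → ∀ G H →
      0 < n → (∀ k → (coeffℤ G ⋆ coeffℤ H) k ≡ + N ℤ.* f k) → IsConstℤ G ⊎ IsConstℤ H
    coprime-case {N} p∤N G H 0<n GH≡Nf with + p ∣? coeffℤ G 0 | + p ∣? coeffℤ H 0
    ... | no p∤G₀ | yes p∣H₀ = inj₁ (degree-argument p∤N G H p∤G₀ p∣H₀ GH≡Nf)
    ... | yes p∣G₀ | no p∤H₀ = inj₂ (degree-argument p∤N H G p∤H₀ p∣G₀
      (λ k → trans (⋆-comm (coeffℤ H) (coeffℤ G) k) (GH≡Nf k)))
    ... | no p∤G₀ | no p∤H₀ = contradiction
      (prime-∣* isPrime _ _ (subst (+ p ∣_) (sym (GH≡Nf 0)) (∣n⇒∣m*n (+ N) (lower∣ 0 0<n)))) [ p∤G₀ , p∤H₀ ]′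
    ... | yes p∣G₀ | yes p∣H₀ with lower∣ 0 0<n
    ...   | divides u f₀≡up = ⊥-elim ([ p∤N , p∤u ]′ (prime-∣* isPrime (+ N) u (*-cancelˡ-∣ (+ p) pp∣)))
      where
      p∤u : ¬ (+ p ∣ u)
      p∤u p∣u = const∤² (subst (+ p ℤ.* + p ∣_) (sym f₀≡up) (*-monoˡ-∣ (+ p) p∣u))
      pp∣ : + p ℤ.* + p ∣ + p ℤ.* (+ N ℤ.* u)
      pp∣ = subst (+ p ℤ.* + p ∣_)
        (trans (GH≡Nf 0) (trans (cong (+ N ℤ.*_) f₀≡up)
          (solve 3 (λ x y z → x :* (y :* z) := z :* (x :* y)) refl (+ N) u (+ p))))
        (∣-trans (*-monoʳ-∣ (+ p) p∣H₀) (*-monoˡ-∣ (coeffℤ H 0) p∣G₀))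
        where open ℤ-Solver.+-*-Solver

  -- By Gauss' lemma a factor p of N can be cancelled from G or from H.
  eisenstein-ℤ : 0 < n → ∀ N → .{{NonZero N}} → Acc _<_ N → ∀ G H →
    (∀ k → (coeffℤ G ⋆ coeffℤ H) k ≡ + N ℤ.* f k) → IsConstℤ G ⊎ IsConstℤ H
  eisenstein-ℤ 0<n N (acc rs) G H GH≡Nf with p ℕ.∣? N
  ... | no  p∤N = coprime-case (p∤N ∘ ∣⇒∣ᵤ) G H 0<n GH≡Nf
  ... | yes (ℕ.divides M N≡Mp) =
    [ (λ p∣G → let G′ , eq = divide-coeffs (+ p) G p∣G in
        Sum.map₁ (IsConstℤ-scale (+ p) G G′ eq) (descend G′ H λ k → trans (sym (⋆-scaleˡ (+ p) (coeffℤ H) eq k)) (GH≡pMf k)))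
    , (λ p∣H → let H′ , eq = divide-coeffs (+ p) H p∣H in
        Sum.map₂ (IsConstℤ-scale (+ p) H H′ eq) (descend G H′ λ k → trans (sym (⋆-scaleʳ (+ p) (coeffℤ G) eq k)) (GH≡pMf k)))
    ]′ (gauss-lemma isPrime G H λ k → subst (+ p ∣_) (sym (GH≡pMf k)) (∣m⇒∣m*n (+ M ℤ.* f k) (divides (+ 1) (sym (ℤ.*-identityˡ (+ p))))))
    where
    instance
      M≢0 : NonZero M
      M≢0 = ℕ.≢-nonZero λ M≡0 → ℕ.≢-nonZero⁻¹ N (trans N≡Mp (cong (_* p) M≡0))
    M<N : M < N
    M<N = subst (M <_) (sym N≡Mp) (ℕ.m<m*n M p (ℕ.nonTrivial⇒n>1 p {{prime⇒nonTrivial isPrime}}))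
    GH≡pMf : ∀ k → (coeffℤ G ⋆ coeffℤ H) k ≡ + p ℤ.* (+ M ℤ.* f k)
    GH≡pMf k = trans (GH≡Nf k) (trans (cong (λ x → x ℤ.* f k) (trans (cong +_ N≡Mp) (ℤ.pos-* M p)))
      (solve 3 (λ x y z → x :* y :* z := y :* (x :* z)) refl (+ M) (+ p) (f k)))
      where open ℤ-Solver.+-*-Solver
    descend : ∀ G′ H′ → (∀ k → + p ℤ.* (coeffℤ G′ ⋆ coeffℤ H′) k ≡ + p ℤ.* (+ M ℤ.* f k)) →
              IsConstℤ G′ ⊎ IsConstℤ H′
    descend G′ H′ eq = eisenstein-ℤ 0<n M (rs M<N) G′ H′ λ k → ℤ.*-cancelˡ-≡ (+ p) _ _ (eq k)

  -- Clearing the denominators `D` and `E` of the factors turns `F = g h` into an integral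
  -- factorisation of `D * E` times `f`, which is the reason for the multiplier `N` in
  -- `eisenstein-ℤ`. Constancy returns to ℚ because `D` and `E` are nonzero.
  eisenstein : 0 < n → ∀ F → (∀ i → coeffℚ F i ≡ ι (f i)) → IrreducibleQ F
  eisenstein 0<n F F≡f = nonconstant , factors
    where
    open ≡-Reasoning
    nonconstant : IsConstℚ F → ⊥
    nonconstant c = top∤ (subst (+ p ∣_) (sym (ι-injective (trans (sym (F≡f n)) (c n 0<n)))) ∣-zero)

    IsConstℚ-from : ∀ {D G g} → .{{NonZero D}} → G IsMultipleOf g By D → IsConstℤ G → IsConstℚ g
    IsConstℚ-from {D} {G} {g} {{D≢0}} eq c i 1≤i = cancel (trans (sym (eq i)) (cong ι (c i 1≤i)))
      where
      D/1 = ι (+ D)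
      instance
        D/1≢0 : ℚ.NonZero D/1
        D/1≢0 = ℚ.≢-nonZero λ e → ℕ.≢-nonZero⁻¹ D {{D≢0}} (ℤ.+-injective (ι-injective e))
      cancel : D/1 ℚ.* coeffℚ g i ≡ ℚ.0ℚ → coeffℚ g i ≡ ℚ.0ℚ
      cancel e = begin
        coeffℚ g i                           ≡⟨ ℚ.*-identityˡ _ ⟨
        ℚ.1ℚ ℚ.* coeffℚ g i                  ≡⟨ cong (ℚ._* coeffℚ g i) (ℚ.*-inverseˡ D/1) ⟨
        ((ℚ.1/ D/1) ℚ.* D/1) ℚ.* coeffℚ g i  ≡⟨ ℚ.*-assoc (ℚ.1/ D/1) D/1 (coeffℚ g i) ⟩
        (ℚ.1/ D/1) ℚ.* (D/1 ℚ.* coeffℚ g i)  ≡⟨ cong ((ℚ.1/ D/1) ℚ.*_) e ⟩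
        (ℚ.1/ D/1) ℚ.* ℚ.0ℚ                  ≡⟨ ℚ.*-zeroʳ (ℚ.1/ D/1) ⟩
        ℚ.0ℚ                                 ∎

    factors : ∀ g h → F ≈ℚ pmulℚ g h → IsConstℚ g ⊎ IsConstℚ h
    factors g h F≈gh with clear-denominators g | clear-denominators h
    ... | D , G , D≢0 , Geq | E , H , E≢0 , Heq =
      Sum.map (IsConstℚ-from {D} {G} {g} Geq) (IsConstℚ-from {E} {H} {h} Heq)
        (eisenstein-ℤ 0<n (D * E) {{ℕ.m*n≢0 D E}} (<-wellFounded _) G H GH≡DEf)
      where
      instance
        _ = D≢0
        _ = E≢0
      GH≡DEf : ∀ k → (coeffℤ G ⋆ coeffℤ H) k ≡ + (D * E) ℤ.* f k
      GH≡DEf k = ι-injective (begin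
        ι ((coeffℤ G ⋆ coeffℤ H) k)
          ≡⟨ ⋆-ι (ι (+ D)) (ι (+ E)) (coeffℚ g) (coeffℚ h) Geq Heq k ⟩
        (ι (+ D) ℚ.* ι (+ E)) ℚ.* (coeffℚ g PolyCoeffℚ.⋆ coeffℚ h) k
          ≡⟨ cong ((ι (+ D) ℚ.* ι (+ E)) ℚ.*_) (trans (sym (PolyCoeffℚ.coeff-pmul g h k)) (trans (sym (F≈gh k)) (F≡f k))) ⟩
        (ι (+ D) ℚ.* ι (+ E)) ℚ.* ι (f k)
          ≡⟨ cong (ℚ._* ι (f k)) (trans (cong ι (ℤ.pos-* D E)) (ι-homo-* (+ D) (+ E))) ⟨
        ι (+ (D * E)) ℚ.* ι (f k)
          ≡⟨ ι-homo-* (+ (D * E)) (f k) ⟨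
        ι (+ (D * E) ℤ.* f k) ∎)

-- The family of matrices

monomial : ℕ → ℕ → ℤ
monomial zero    zero    = + 1
monomial zero    (suc i) = + 0
monomial (suc n) i       = shift (monomial n) i

monomial-diag : ∀ n → monomial n n ≡ + 1
monomial-diag zero    = refl
monomial-diag (suc n) = monomial-diag n

monomial-off : ∀ n i → i ≢ n → monomial n i ≡ + 0
monomial-off zero    zero    i≢n = contradiction refl i≢n
monomial-off zero    (suc i) i≢n = refl
monomial-off (suc n) zero    i≢n = refl
monomial-off (suc n) (suc i) i≢n = monomial-off n i (i≢n ∘ cong suc)

-- The polynomial Σ_{q<s} d(q) X^q, kept as a sum of monomials since the determinant recursion in
-- `block-column` adds one monomial at a time.
truncation : ℕ → (ℕ → ℕ) → ℕ → ℤ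
truncation zero    d i = + 0
truncation (suc s) d i = + d s ℤ.* monomial s i ℤ.+ truncation s d i

truncation-≥ : ∀ s d i → s ≤ i → truncation s d i ≡ + 0
truncation-≥ zero    d i s≤i = refl
truncation-≥ (suc s) d i s<i = trans
  (cong₂ ℤ._+_ (trans (cong (+ d s ℤ.*_) (monomial-off s i (ℕ.>⇒≢ s<i))) (ℤ.*-zeroʳ (+ d s)))
    (truncation-≥ s d i (ℕ.<⇒≤ s<i)))
  refl

truncation-< : ∀ s d i → i < s → truncation s d i ≡ + d i
truncation-< (suc s) d i i<1+s with i ℕ.≟ s
... | yes refl = trans
  (cong₂ ℤ._+_ (trans (cong (+ d s ℤ.*_) (monomial-diag s)) (ℤ.*-identityʳ (+ d s))) (truncation-≥ s d s ℕ.≤-refl))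
  (ℤ.+-identityʳ _)
... | no i≢s = trans
  (cong₂ ℤ._+_ (trans (cong (+ d s ℤ.*_) (monomial-off s i i≢s)) (ℤ.*-zeroʳ (+ d s)))
    (truncation-< s d i (ℕ.≤∧≢⇒< (ℕ.≤-pred i<1+s) i≢s)))
  (ℤ.+-identityˡ _)

shiftℕ : (ℕ → ℕ) → ℕ → ℕ
shiftℕ f zero    = 0
shiftℕ f (suc i) = f i

-- Coefficients of Σ_{l<t} W^l e_l(X) X^{t-1-l}, where e l i is the coefficient of X^i in e_l.
digitSum : ℕ → (ℕ → ℕ → ℕ) → ℕ → ℕ → ℕ
digitSum W e zero    i = 0
digitSum W e (suc t) i = shiftℕ (digitSum W e t) i ℕ.+ e t i * W ^ t

-- Weight of the superdiagonal entry in row p, as a function of m ∸ p.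
weight : ℕ → ℕ → ℕ
weight W zero          = 1
weight W (suc zero)    = 2
weight W (suc (suc _)) = W

-- The digits e l fill the column m − 1 − l, from the last row upwards.
entry : ℕ → ℕ → (ℕ → ℕ → ℕ) → ℕ → ℕ → ℕ
entry m W e p k with k ℕ.≟ suc p | k ℕ.<? m | m ℕ.≤? p
... | yes _ | _     | _     = weight W (m ∸ p)
... | no  _ | yes _ | yes _ = e (m ∸ suc k) (m ℕ.+ m ∸ p)
... | no  _ | yes _ | no _  = 0
... | no  _ | no _  | _     = 0

module Family (m W : ℕ) (e : ℕ → ℕ → ℕ) (e-support : ∀ l i → m < i → e l i ≡ 0) where

  a : ℕ → ℕ → ℕ
  a = entry m W e

  a-super : ∀ p → a p (suc p) ≡ weight W (m ∸ p)
  a-super p with suc p ℕ.≟ suc p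
  ... | yes _ = refl
  ... | no ne = contradiction refl ne

  a-block : ∀ p k → m ≤ p → k < m → a p k ≡ e (m ∸ suc k) (m ℕ.+ m ∸ p)
  a-block p k m≤p k<m with k ℕ.≟ suc p | k ℕ.<? m | m ℕ.≤? p
  ... | yes refl | _ | _ = contradiction (ℕ.≤-trans (ℕ.n≤1+n _) (ℕ.≤-trans k<m m≤p)) (ℕ.<-irrefl refl)
  ... | no _ | yes _ | yes _ = refl
  ... | no _ | no ne | _ = contradiction k<m ne
  ... | no _ | yes _ | no ne = contradiction m≤p ne

  a-zero-right : ∀ p k → k ≢ suc p → m ≤ k → a p k ≡ 0
  a-zero-right p k k≢ m≤k with k ℕ.≟ suc p | k ℕ.<? m | m ℕ.≤? p
  ... | yes eq | _ | _ = contradiction eq k≢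
  ... | no _ | yes k<m | _ = contradiction m≤k (ℕ.<⇒≱ k<m)
  ... | no _ | no _ | _ = refl

  a-zero-upper : ∀ p k → k ≢ suc p → p < m → a p k ≡ 0
  a-zero-upper p k k≢ p<m with k ℕ.≟ suc p | k ℕ.<? m | m ℕ.≤? p
  ... | yes eq | _ | _ = contradiction eq k≢
  ... | no _ | yes _ | yes m≤p = contradiction m≤p (ℕ.<⇒≱ p<m)
  ... | no _ | yes _ | no _ = refl
  ... | no _ | no _ | _ = refl

  a-diag : ∀ k → a k k ≡ 0
  a-diag k = [ a-zero-upper k k k≢1+k , a-zero-right k k k≢1+k ]′ (ℕ.<-≤-connex k m)
    where k≢1+k = ℕ.<⇒≢ (ℕ.n<1+n k)

  -- The entries of XI - A as coefficient sequences, indexed by natural numbers so that a trailing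
  -- block is given by its first index alone.
  E : ℕ → ℕ → ℕ → ℤ
  E p k with p ℕ.≟ k
  ... | yes _ = coeffℤ (ℤ.- (+ a p k) ∷ + 1 ∷ [])
  ... | no  _ = coeffℤ (ℤ.- (+ a p k) ∷ [])

  E-diag : ∀ k → E k k ≗ coeffℤ (+ 0 ∷ + 1 ∷ [])
  E-diag k i with k ℕ.≟ k
  ... | yes _ = cong (λ x → coeffℤ (ℤ.- (+ x) ∷ + 1 ∷ []) i) (a-diag k)
  ... | no ne = contradiction refl ne

  E-off : ∀ p k → p ≢ k → ∀ {x} → a p k ≡ x → E p k ≗ coeffℤ (ℤ.- (+ x) ∷ [])
  E-off p k p≢k eq i with p ℕ.≟ k
  ... | yes eq = contradiction eq p≢k
  ... | no _ = cong (λ x → coeffℤ (ℤ.- (+ x) ∷ []) i) eq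

  coeff-0 : ∀ i → coeffℤ (+ 0 ∷ []) i ≡ + 0
  coeff-0 zero    = refl
  coeff-0 (suc i) = refl

  E-zero-right : ∀ p k → p ≢ k → k ≢ suc p → m ≤ k → ∀ i → E p k i ≡ + 0
  E-zero-right p k p≢k k≢ m≤k i = trans (E-off p k p≢k (a-zero-right p k k≢ m≤k) i) (coeff-0 i)

  E-zero-upper : ∀ p k → p ≢ k → k ≢ suc p → p < m → ∀ i → E p k i ≡ + 0
  E-zero-upper p k p≢k k≢ p<m i = trans (E-off p k p≢k (a-zero-upper p k k≢ p<m) i) (coeff-0 i)

  E-hessenberg : ∀ r j i → E r (suc (suc (r ℕ.+ j))) i ≡ + 0
  E-hessenberg r j i =
    [ (λ r<m → E-zero-upper r _ r≢k k≢1+r r<m i)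
    , (λ m≤r → E-zero-right r _ r≢k k≢1+r (ℕ.≤-trans m≤r (ℕ.<⇒≤ r<k)) i)
    ]′ (ℕ.<-≤-connex r m)
    where
    r<k : r < suc (suc (r ℕ.+ j))
    r<k = s≤s (ℕ.≤-trans (ℕ.m≤m+n r j) (ℕ.n≤1+n _))
    r≢k = ℕ.<⇒≢ r<k
    k≢1+r : suc (suc (r ℕ.+ j)) ≢ suc r
    k≢1+r = ℕ.>⇒≢ (s≤s (s≤s (ℕ.m≤m+n r j)))

  -- The entry of XI - A is minus the weight, and the sign of its cofactor cancels this minus.
  super-⋆ : ∀ k g i → ℤ.- (E k (suc k) ⋆ g) i ≡ + weight W (m ∸ k) ℤ.* g i
  super-⋆ k g i = trans
    (cong ℤ.-_ (trans (⋆-cong {g = g} (E-off k (suc k) (ℕ.<⇒≢ (ℕ.n<1+n k)) (a-super k)) (λ _ → refl) i)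
      (⋆-constˡ g (λ _ → refl) i)))
    (solve 2 (λ w x → :- (:- w :* x) := w :* x) refl (+ weight W (m ∸ k)) (g i))
    where open ℤ-Solver.+-*-Solver

  hessDet-zero : ∀ s k c → (∀ p → k ≤ p → ∀ i → c p i ≡ + 0) → ∀ i → hessDet E k s c i ≡ + 0
  hessDet-zero zero    k c c≡0 i = c≡0 k ℕ.≤-refl i
  hessDet-zero (suc s) k c c≡0 i = trans
    (cong₂ ℤ._+_ (⋆-zeroˡ _ (c≡0 k ℕ.≤-refl) i)
      (trans (super-⋆ k _ i) (trans (cong (+ weight W (m ∸ k) ℤ.*_) (hessDet-zero s (suc k) c (λ p k<p → c≡0 p (ℕ.<⇒≤ k<p)) i))
        (ℤ.*-zeroʳ (+ weight W (m ∸ k))))))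
    refl

  -- From column `m` on, only the diagonal and the superdiagonal are nonzero, so the block is upper
  -- triangular with X on its diagonal.
  trailing-monomial : ∀ s k → m ≤ k → hessDet E k s (λ r → E r k) ≗ monomial (suc s)
  trailing-monomial zero    k m≤k zero    = E-diag k 0
  trailing-monomial zero    k m≤k (suc zero) = E-diag k 1
  trailing-monomial zero    k m≤k (suc (suc i)) = E-diag k (suc (suc i))
  trailing-monomial (suc s) k m≤k i = trans
    (cong₂ ℤ._+_
      (trans (⋆-Xˡ (hessDet E (suc k) s (λ r → E r (suc k))) (E-diag k) i)
        (shift-cong (trailing-monomial s (suc k) (ℕ.≤-trans m≤k (ℕ.n≤1+n k))) i))
      (trans (super-⋆ k _ i) (trans (cong (+ weight W (m ∸ k) ℤ.*_)
        (hessDet-zero s (suc k) (λ r → E r k)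
          (λ p k<p → E-zero-right p k (ℕ.>⇒≢ k<p) (ℕ.<⇒≢ (ℕ.≤-trans k<p (ℕ.n≤1+n p))) m≤k) i))
        (ℤ.*-zeroʳ (+ weight W (m ∸ k))))))
    (ℤ.+-identityʳ _)
    where
    shift-cong : ∀ {f g} → f ≗ g → shift f ≗ shift g
    shift-cong eq zero    = refl
    shift-cong eq (suc i) = eq i

  -- From row `m` on all superdiagonal weights are 1. The entry of `c` in row 2m - q therefore meets
  -- the trailing block of size q, which is X^q: reading the column from the bottom up gives the
  -- coefficients of a polynomial.
  block-column : ∀ s k c d → m ≤ k → k ℕ.+ s ≡ m ℕ.+ m →
    (∀ p → k ≤ p → c p ≗ coeffℤ (ℤ.- (+ d (m ℕ.+ m ∸ p)) ∷ [])) →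
    ∀ i → hessDet E k s c i ≡ ℤ.- truncation (suc s) d i
  block-column zero k c d m≤k k≡ c≡ i = trans (c≡ k ℕ.≤-refl i) (trans
    (cong (λ x → coeffℤ (ℤ.- (+ d x) ∷ []) i) (trans (cong (_∸ k) (sym k≡)) (ℕ.m+n∸m≡n k 0)))
    (constant i))
    where
    constant : ∀ i → coeffℤ (ℤ.- (+ d 0) ∷ []) i ≡ ℤ.- truncation 1 d i
    constant zero    = cong ℤ.-_ (sym (trans (ℤ.+-identityʳ _) (ℤ.*-identityʳ (+ d 0))))
    constant (suc i) = cong ℤ.-_ (sym (trans (ℤ.+-identityʳ _) (ℤ.*-zeroʳ (+ d 0))))
  block-column (suc s) k c d m≤k k+s≡ c≡ i = begin
    (c k ⋆ hessDet E (suc k) s (λ r → E r (suc k))) i ℤ.+ ℤ.- (E k (suc k) ⋆ hessDet E (suc k) s c) i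
      ≡⟨ cong₂ ℤ._+_
           (trans (⋆-cong (c≡ k ℕ.≤-refl) (trailing-monomial s (suc k) (ℕ.≤-trans m≤k (ℕ.n≤1+n k))) i)
             (trans (⋆-constˡ (monomial (suc s)) (λ _ → refl) i) (cong (λ x → ℤ.- (+ d x) ℤ.* monomial (suc s) i) ∸≡)))
           (trans (super-⋆ k _ i) (cong₂ (λ x y → + weight W x ℤ.* y) (ℕ.m≤n⇒m∸n≡0 m≤k)
             (block-column s (suc k) c d (ℕ.≤-trans m≤k (ℕ.n≤1+n k)) (trans (sym (ℕ.+-suc k s)) k+s≡)
               (λ p k<p → c≡ p (ℕ.<⇒≤ k<p)) i))) ⟩
    ℤ.- (+ d (suc s)) ℤ.* monomial (suc s) i ℤ.+ + 1 ℤ.* (ℤ.- truncation (suc s) d i)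
      ≡⟨ solve 3 (λ x y z → :- x :* y :+ con (+ 1) :* (:- z) := :- (x :* y :+ z)) refl
           (+ d (suc s)) (monomial (suc s) i) (truncation (suc s) d i) ⟩
    ℤ.- truncation (suc (suc s)) d i ∎
    where
    open ≡-Reasoning
    open ℤ-Solver.+-*-Solver
    ∸≡ : m ℕ.+ m ∸ k ≡ suc s
    ∸≡ = trans (cong (_∸ k) (sym k+s≡)) (ℕ.m+n∸m≡n k (suc s))

  -- The product of the superdiagonal entries in rows m - t to m - 1. For t > 0 it contains the
  -- entry 2 exactly once.
  weights : ℕ → ℕ
  weights zero    = 1
  weights (suc t) = weight W (suc t) * weights t

  weights-suc : ∀ t → weights (suc t) ≡ 2 * W ^ t
  weights-suc zero    = refl
  weights-suc (suc t) = trans (cong (W *_) (weights-suc t))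
    (trans (sym (ℕ.*-assoc W 2 _)) (trans (cong (_* W ^ t) (ℕ.*-comm W 2)) (ℕ.*-assoc 2 W _)))

  ∸-from-+ : ∀ k t → k ℕ.+ t ≡ m → m ∸ k ≡ t
  ∸-from-+ k t k+t≡m = trans (cong (_∸ k) (sym k+t≡m)) (ℕ.m+n∸m≡n k t)

  -- While the first column has a zero on top, only the superdiagonal term of the expansion
  -- survives, so the expansion runs down to row `m` and collects the weights.
  skip-chain : ∀ t k c → k ℕ.+ t ≡ m → (∀ p → k ≤ p → p < m → ∀ i → c p i ≡ + 0) →
    ∀ i → hessDet E k (t ℕ.+ m) c i ≡ + weights t ℤ.* hessDet E m m c i
  skip-chain zero    k c k+t≡m c≡0 i =
    trans (cong (λ x → hessDet E x m c i) (trans (sym (ℕ.+-identityʳ k)) k+t≡m)) (sym (ℤ.*-identityˡ _))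
  skip-chain (suc t) k c k+t≡m c≡0 i = begin
    (c k ⋆ hessDet E (suc k) (t ℕ.+ m) (λ r → E r (suc k))) i ℤ.+ ℤ.- (E k (suc k) ⋆ hessDet E (suc k) (t ℕ.+ m) c) i
      ≡⟨ cong₂ ℤ._+_ (⋆-zeroˡ _ (c≡0 k ℕ.≤-refl (ℕ.m+n≤o⇒m≤o (suc k) (ℕ.≤-reflexive 1+k+t≡m))) i)
           (trans (super-⋆ k _ i) (cong₂ (λ x y → + weight W x ℤ.* y) (∸-from-+ k (suc t) k+t≡m)
             (skip-chain t (suc k) c 1+k+t≡m (λ p k<p → c≡0 p (ℕ.<⇒≤ k<p)) i))) ⟩
    + 0 ℤ.+ + weight W (suc t) ℤ.* (+ weights t ℤ.* hessDet E m m c i)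
      ≡⟨ ℤ.+-identityˡ _ ⟩
    + weight W (suc t) ℤ.* (+ weights t ℤ.* hessDet E m m c i)
      ≡⟨ ℤ.*-assoc (+ weight W (suc t)) (+ weights t) _ ⟨
    + weight W (suc t) ℤ.* + weights t ℤ.* hessDet E m m c i
      ≡⟨ cong (ℤ._* hessDet E m m c i) (ℤ.pos-* (weight W (suc t)) (weights t)) ⟨
    + weights (suc t) ℤ.* hessDet E m m c i ∎
    where
    open ≡-Reasoning
    1+k+t≡m : suc k ℕ.+ t ≡ m
    1+k+t≡m = trans (sym (ℕ.+-suc k t)) k+t≡m

  truncation-full : ∀ l i → truncation (suc m) (e l) i ≡ + e l i
  truncation-full l i with i ℕ.<? suc m
  ... | yes i<1+m = truncation-< (suc m) (e l) i i<1+m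
  ... | no  i≮1+m = trans (truncation-≥ (suc m) (e l) i (ℕ.≮⇒≥ i≮1+m)) (cong +_ (sym (e-support l i (ℕ.≮⇒≥ i≮1+m))))

  -- Induction on trailing blocks. The diagonal entry X multiplies the polynomial of the next block,
  -- which shifts the digit sum. The superdiagonal term runs down to the digit block with total
  -- weight 2 W^t and contributes -2 W^t e_t(X). Together they give the recursion of `digitSum`.
  hessDet-digitSum : ∀ t k → k ℕ.+ t ≡ m → ∀ i →
    hessDet E k (t ℕ.+ m) (λ r → E r k) i ≡ monomial (suc (t ℕ.+ m)) i ℤ.- + 2 ℤ.* + digitSum W e t i
  hessDet-digitSum zero k k+t≡m i = trans
    (trailing-monomial m k (ℕ.≤-reflexive (sym (trans (sym (ℕ.+-identityʳ k)) k+t≡m))) i)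
    (sym (ℤ.+-identityʳ _))
  hessDet-digitSum (suc t) k k+t≡m i = begin
    (E k k ⋆ P) i ℤ.+ ℤ.- (E k (suc k) ⋆ hessDet E (suc k) (t ℕ.+ m) (λ r → E r k)) i
      ≡⟨ cong₂ ℤ._+_ (⋆-Xˡ P (E-diag k) i) (super-⋆ k _ i) ⟩
    shift P i ℤ.+ + weight W (m ∸ k) ℤ.* hessDet E (suc k) (t ℕ.+ m) (λ r → E r k) i
      ≡⟨ cong (ℤ._+_ (shift P i)) (cong₂ (λ x y → + weight W x ℤ.* y) (∸-from-+ k (suc t) k+t≡m)
           (trans (skip-chain t (suc k) (λ r → E r k) 1+k+t≡m upper≡0 i)
             (cong (+ weights t ℤ.*_) (trans (block-column m m (λ r → E r k) (e t) ℕ.≤-refl refl column i)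
               (cong ℤ.-_ (truncation-full t i)))))) ⟩
    shift P i ℤ.+ + weight W (suc t) ℤ.* (+ weights t ℤ.* (ℤ.- + e t i))
      ≡⟨ cong (ℤ._+_ (shift P i)) (begin
           + weight W (suc t) ℤ.* (+ weights t ℤ.* (ℤ.- + e t i))
             ≡⟨ ℤ.*-assoc (+ weight W (suc t)) (+ weights t) _ ⟨
           + weight W (suc t) ℤ.* + weights t ℤ.* (ℤ.- + e t i)
             ≡⟨ cong (ℤ._* (ℤ.- + e t i)) (trans (sym (ℤ.pos-* (weight W (suc t)) (weights t)))
                  (trans (cong +_ (weights-suc t)) (ℤ.pos-* 2 (W ^ t)))) ⟩
           + 2 ℤ.* + (W ^ t) ℤ.* (ℤ.- + e t i)
             ≡⟨ solve 2 (λ x y → con (+ 2) :* x :* (:- y) := :- (con (+ 2) :* (y :* x))) refl (+ (W ^ t)) (+ e t i) ⟩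
           ℤ.- (+ 2 ℤ.* (+ e t i ℤ.* + (W ^ t)))
             ≡⟨ cong (λ x → ℤ.- (+ 2 ℤ.* x)) (ℤ.pos-* (e t i) (W ^ t)) ⟨
           ℤ.- (+ 2 ℤ.* + (e t i * W ^ t)) ∎) ⟩
    shift P i ℤ.- + 2 ℤ.* + (e t i * W ^ t)
      ≡⟨ combine i (e t i * W ^ t) ⟩
    monomial (suc (suc t ℕ.+ m)) i ℤ.- + 2 ℤ.* + digitSum W e (suc t) i ∎
    where
    open ≡-Reasoning
    open ℤ-Solver.+-*-Solver
    P : ℕ → ℤ
    P = hessDet E (suc k) (t ℕ.+ m) (λ r → E r (suc k))
    1+k+t≡m : suc k ℕ.+ t ≡ m
    1+k+t≡m = trans (sym (ℕ.+-suc k t)) k+t≡m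
    k<m : k < m
    k<m = ℕ.m+n≤o⇒m≤o (suc k) (ℕ.≤-reflexive 1+k+t≡m)
    upper≡0 : ∀ p → k < p → p < m → ∀ i → E p k i ≡ + 0
    upper≡0 p k<p p<m = E-zero-upper p k (ℕ.>⇒≢ k<p) (ℕ.<⇒≢ (ℕ.≤-trans k<p (ℕ.n≤1+n p))) p<m
    column : ∀ p → m ≤ p → E p k ≗ coeffℤ (ℤ.- (+ e t (m ℕ.+ m ∸ p)) ∷ [])
    column p m≤p = E-off p k (ℕ.>⇒≢ (ℕ.≤-trans k<m m≤p))
      (trans (a-block p k m≤p k<m) (cong (λ x → e x (m ℕ.+ m ∸ p)) (∸-from-+ (suc k) t 1+k+t≡m)))
    combine : ∀ i x → shift P i ℤ.- + 2 ℤ.* + x ≡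
      monomial (suc (suc t ℕ.+ m)) i ℤ.- + 2 ℤ.* + (shiftℕ (digitSum W e t) i ℕ.+ x)
    combine zero    x = refl
    combine (suc i) x = begin
      P i ℤ.- + 2 ℤ.* + x
        ≡⟨ cong (ℤ._- + 2 ℤ.* + x) (hessDet-digitSum t (suc k) 1+k+t≡m i) ⟩
      M ℤ.- + 2 ℤ.* D ℤ.- + 2 ℤ.* + x
        ≡⟨ solve 3 (λ u v w → u :- con (+ 2) :* v :- con (+ 2) :* w := u :- con (+ 2) :* (v :+ w)) refl M D (+ x) ⟩
      M ℤ.- + 2 ℤ.* (D ℤ.+ + x)
        ≡⟨ cong (λ y → M ℤ.- + 2 ℤ.* y) (ℤ.pos-+ (digitSum W e t i) x) ⟨
      M ℤ.- + 2 ℤ.* + (digitSum W e t i ℕ.+ x) ∎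
      where
      M D : ℤ
      M = monomial (suc (t ℕ.+ m)) i
      D = + digitSum W e t i

  matrix : Fin (suc (m ℕ.+ m)) → Fin (suc (m ℕ.+ m)) → ℕ
  matrix i j = a (toℕ i) (toℕ j)

  coeff-charMat : ∀ i j → coeffℤ (charMat (suc (m ℕ.+ m)) matrix i j) ≗ E (toℕ i) (toℕ j)
  coeff-charMat i j t with i Fin.≟ j | toℕ i ℕ.≟ toℕ j
  ... | yes _ | yes _ = refl
  ... | no  _ | no _  = refl
  ... | yes eq | no ne = contradiction (cong toℕ eq) ne
  ... | no ne | yes eq = contradiction (Fin.toℕ-injective eq) ne

  coeff-det : ∀ i → coeffℤ (detℤ (suc (m ℕ.+ m)) (charMat (suc (m ℕ.+ m)) matrix)) i ≡
              monomial (suc (m ℕ.+ m)) i ℤ.- + 2 ℤ.* + digitSum W e m i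
  coeff-det i = trans
    (det-hessenberg {E} E-hessenberg 0 (m ℕ.+ m) (λ r → E r 0) (charMat _ matrix)
      (λ r → coeff-charMat r zero) (λ r j → coeff-charMat r (suc j)) i)
    (hessDet-digitSum m 0 refl i)

-- Uniqueness of base-W digits

mutual
  -- Each coefficient is a number written with `t` digits in base `W`: level `l` contributes one
  -- digit at W^l, namely a coefficient of e_l or zero.
  digitSum-< : ∀ W e → (∀ l i → e l i < W) → ∀ t i → digitSum W e t i < W ^ t
  digitSum-< W e e<W zero    i = s≤s z≤n
  digitSum-< W e e<W (suc t) i = begin-strict
    shiftℕ (digitSum W e t) i ℕ.+ e t i * W ^ t  <⟨ ℕ.+-monoˡ-< (e t i * W ^ t) (shift-digitSum-< W e e<W t i) ⟩
    W ^ t ℕ.+ e t i * W ^ t                      ≤⟨ ℕ.*-monoˡ-≤ (W ^ t) (e<W t i) ⟩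
    W * W ^ t                                    ∎
    where open ℕ.≤-Reasoning

  shift-digitSum-< : ∀ W e → (∀ l i → e l i < W) → ∀ t i → shiftℕ (digitSum W e t) i < W ^ t
  shift-digitSum-< W e e<W t zero    = ℕ.m^n>0 W {{ℕ.>-nonZero (ℕ.≤-trans (s≤s z≤n) (e<W 0 0))}} t
  shift-digitSum-< W e e<W t (suc i) = digitSum-< W e e<W t i

-- Each e_l has degree at most `m` and is multiplied by a power of X below X^t.
digitSum-support : ∀ W e m → (∀ l i → m < i → e l i ≡ 0) → ∀ t i → m ℕ.+ t ≤ i → digitSum W e t i ≡ 0
digitSum-support W e m e≡0 zero    i       m+t≤i = refl
digitSum-support W e m e≡0 (suc t) zero    m+t≤i = contradiction (subst (_≤ 0) (ℕ.+-suc m t) m+t≤i) λ ()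
digitSum-support W e m e≡0 (suc t) (suc i) m+t≤i = cong₂ ℕ._+_
  (digitSum-support W e m e≡0 t i (ℕ.≤-pred (subst (_≤ suc i) (ℕ.+-suc m t) m+t≤i)))
  (cong (_* W ^ t) (e≡0 t (suc i) (s≤s (ℕ.m+n≤o⇒m≤o m (ℕ.≤-pred (subst (_≤ suc i) (ℕ.+-suc m t) m+t≤i))))))

divMod-unique : ∀ {a a′ D} b b′ → a < D → a′ < D → a ℕ.+ b * D ≡ a′ ℕ.+ b′ * D → a ≡ a′ × b ≡ b′
divMod-unique {a} {a′} {D} b b′ a<D a′<D eq = a≡a′ ,
  ℕ.*-cancelʳ-≡ b b′ D (ℕ.+-cancelˡ-≡ a _ _ (trans eq (cong (ℕ._+ b′ * D) (sym a≡a′))))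
  where
  instance
    D≢0 : NonZero D
    D≢0 = ℕ.>-nonZero (ℕ.≤-trans (s≤s z≤n) a<D)
  a≡a′ : a ≡ a′
  a≡a′ = trans (sym (trans (ℕ.[m+kn]%n≡m%n a b D) (ℕ.m<n⇒m%n≡m a<D)))
    (trans (cong (_% D) eq) (trans (ℕ.[m+kn]%n≡m%n a′ b′ D) (ℕ.m<n⇒m%n≡m a′<D)))

-- Division by W^t separates the leading digit `e t i`, the quotient, from the shifted sum of the
-- lower levels, the remainder. The remainder is read at `suc i` to undo the shift.
digitSum-suc-injective : ∀ W e e′ → (∀ l i → e l i < W) → (∀ l i → e′ l i < W) →
  ∀ t → digitSum W e (suc t) ≗ digitSum W e′ (suc t) →
  digitSum W e t ≗ digitSum W e′ t × e t ≗ e′ t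
digitSum-suc-injective W e e′ e<W e′<W t eq = (λ i → proj₁ (both (suc i))) , (λ i → proj₂ (both i))
  where
  both : ∀ i → shiftℕ (digitSum W e t) i ≡ shiftℕ (digitSum W e′ t) i × e t i ≡ e′ t i
  both i = divMod-unique (e t i) (e′ t i) (shift-digitSum-< W e e<W t i) (shift-digitSum-< W e′ e′<W t i) (eq i)

digitSum-injective : ∀ W e e′ → (∀ l i → e l i < W) → (∀ l i → e′ l i < W) →
  ∀ t → digitSum W e t ≗ digitSum W e′ t → ∀ l → l < t → e l ≗ e′ l
digitSum-injective W e e′ e<W e′<W (suc t) eq l l<1+t
  with l ℕ.≟ t | digitSum-suc-injective W e e′ e<W e′<W t eq
... | yes refl | _ , e≗   = e≗
... | no  l≢t  | sum≗ , _ =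
  digitSum-injective W e e′ e<W e′<W t sum≗ l (ℕ.≤∧≢⇒< (ℕ.≤-pred l<1+t) l≢t)

-- Counting

extend : ∀ {A : Set} {n} → A → (Fin n → A) → ℕ → A
extend {n = zero}  d f k       = d
extend {n = suc n} d f zero    = f zero
extend {n = suc n} d f (suc k) = extend d (f ∘ suc) k

extend-toℕ : ∀ {A : Set} {n} d (f : Fin n → A) i → extend d f (toℕ i) ≡ f i
extend-toℕ d f zero    = refl
extend-toℕ d f (suc i) = extend-toℕ d (f ∘ suc) i

extend-≥ : ∀ {A : Set} {n} d (f : Fin n → A) {k} → n ≤ k → extend d f k ≡ d
extend-≥ {n = zero}  d f n≤k       = refl
extend-≥ {n = suc n} d f (s≤s n≤k) = extend-≥ d (f ∘ suc) n≤k

extend-all : ∀ {A : Set} {n} (P : A → Set) {d} {f : Fin n → A} → P d → (∀ i → P (f i)) → ∀ k → P (extend d f k)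
extend-all {n = zero}  P Pd Pf k       = Pd
extend-all {n = suc n} P Pd Pf zero    = Pf zero
extend-all {n = suc n} P Pd Pf (suc k) = extend-all P Pd (Pf ∘ suc) k

coeff-tabulate-< : ∀ {n} (g : ℕ → ℤ) i → i < n → coeffℤ (toList (tabulate {n = n} (g ∘ toℕ))) i ≡ g i
coeff-tabulate-< g zero    (s≤s _)   = refl
coeff-tabulate-< g (suc i) (s≤s i<n) = coeff-tabulate-< (g ∘ suc) i i<n

coeff-toList-≥ : ∀ {n} (v : Vec ℤ n) i → n ≤ i → coeffℤ (toList v) i ≡ + 0
coeff-toList-≥ []      i       n≤i       = refl
coeff-toList-≥ (x ∷ v) (suc i) (s≤s n≤i) = coeff-toList-≥ v i n≤i

coeff-map-ι : ∀ p i → coeffℚ (map ι p) i ≡ ι (coeffℤ p i)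
coeff-map-ι []      i       = refl
coeff-map-ι (a ∷ p) zero    = refl
coeff-map-ι (a ∷ p) (suc i) = coeff-map-ι p i

funToFin-cong : ∀ {m n} {f g : Fin m → Fin n} → f ≗ g → Fin.funToFin f ≡ Fin.funToFin g
funToFin-cong {zero}  eq = refl
funToFin-cong {suc m} eq = cong₂ Fin.combine (eq zero) (funToFin-cong (eq ∘ suc))

prime-∣^ : ∀ {p} → Prime p → ∀ x t → p ℕ.∣ x ^ t → p ℕ.∣ x
prime-∣^ pr x zero    p∣1 = ℕ.∣-trans p∣1 (ℕ.1∣ x)
prime-∣^ pr x (suc t) p∣  = [ (λ p∣x → p∣x) , prime-∣^ pr x t ]′ (euclidsLemma x (x ^ t) pr p∣)

-- The digit in position (0 , 0), the corner entry of the matrix, is fixed to be 1: with W odd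
-- this makes the constant coefficient of the characteristic polynomial 2 modulo 4.
module Digits (m′ W : ℕ) (1<W : 1 < W) where

  m n freeDigits : ℕ
  m = suc m′
  n = suc (m ℕ.+ m)
  -- This is m(m + 1) - 1, written so that `suc freeDigits` and `m * suc m` agree by computation, as
  -- the patterns of `digit` require.
  freeDigits = suc m′ ℕ.+ m′ * suc m

  digit : (Fin freeDigits → Fin W) → Fin (m * suc m) → ℕ
  digit x zero    = 1
  digit x (suc i) = toℕ (x i)

  digit-< : ∀ x i → digit x i < W
  digit-< x zero    = 1<W
  digit-< x (suc i) = Fin.toℕ<n (x i)

  row : (Fin freeDigits → Fin W) → Fin m → ℕ → ℕ
  row x k = extend 0 (λ q → digit x (Fin.combine k q))

  -- The reversal matches the one in `entry`, so that `row x k` fills column `k` of the matrix.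
  e : (Fin freeDigits → Fin W) → ℕ → ℕ → ℕ
  e x l = extend (λ _ → 0) (row x) (m ∸ suc l)

  row-< : ∀ x k i → row x k i < W
  row-< x k = extend-all (_< W) {f = λ q → digit x (Fin.combine k q)} 0<W (λ q → digit-< x (Fin.combine k q))
    where 0<W = ℕ.<-trans (s≤s z≤n) 1<W

  e-< : ∀ x l i → e x l i < W
  e-< x l = extend-all (λ f → ∀ i → f i < W) {f = row x} (λ i → 0<W) (row-< x) (m ∸ suc l)
    where 0<W = ℕ.<-trans (s≤s z≤n) 1<W

  e-support : ∀ x l i → m < i → e x l i ≡ 0
  e-support x l i m<i = extend-all (λ f → f i ≡ 0) {f = row x} refl
    (λ k → extend-≥ 0 (λ q → digit x (Fin.combine k q)) m<i) (m ∸ suc l)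

  e-fixed : ∀ x → e x m′ 0 ≡ 1
  e-fixed x = cong (λ k → extend (λ _ → 0) (row x) k 0) (ℕ.n∸n≡0 m)

  -- `Fin.opposite` undoes the reversal in `e`, so every digit can be recovered from `e x`.
  e-digit : ∀ x k q → e x (toℕ (Fin.opposite k)) (toℕ q) ≡ digit x (Fin.combine k q)
  e-digit x k q = begin
    extend (λ _ → 0) (row x) (m ∸ suc (toℕ (Fin.opposite k))) (toℕ q)
      ≡⟨ cong (λ l → extend (λ _ → 0) (row x) l (toℕ q))
           (trans (sym (Fin.opposite-prop (Fin.opposite k))) (cong toℕ (Fin.opposite-involutive k))) ⟩
    extend (λ _ → 0) (row x) (toℕ k) (toℕ q)  ≡⟨ cong (λ f → f (toℕ q)) (extend-toℕ _ (row x) k) ⟩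
    row x k (toℕ q)                           ≡⟨ extend-toℕ 0 _ q ⟩
    digit x (Fin.combine k q)                 ∎
    where open ≡-Reasoning

  e-injective : ∀ x y → (∀ l → l < m → e x l ≗ e y l) → x ≗ y
  e-injective x y eq i = Fin.toℕ-injective (begin
    digit x (suc i)                     ≡⟨ cong (digit x) (Fin.combine-remQuot {m} (suc m) (suc i)) ⟨
    digit x (Fin.combine k q)           ≡⟨ e-digit x k q ⟨
    e x (toℕ (Fin.opposite k)) (toℕ q)  ≡⟨ eq _ (Fin.toℕ<n (Fin.opposite k)) (toℕ q) ⟩
    e y (toℕ (Fin.opposite k)) (toℕ q)  ≡⟨ e-digit y k q ⟩
    digit y (Fin.combine k q)           ≡⟨ cong (digit y) (Fin.combine-remQuot {m} (suc m) (suc i)) ⟩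
    digit y (suc i)                     ∎)
    where
    open ≡-Reasoning
    k = proj₁ (Fin.remQuot {m} (suc m) (suc i))
    q = proj₂ (Fin.remQuot {m} (suc m) (suc i))

  A : (Fin freeDigits → Fin W) → Fin n → Fin n → ℕ
  A x = Family.matrix m W (e x) (e-support x)

  D : (Fin freeDigits → Fin W) → ℕ → ℕ
  D x = digitSum W (e x) m

  -- Abstract, to keep the type checker from unfolding the determinant.
  abstract
    χ : (Fin freeDigits → Fin W) → Vec ℤ (suc n)
    χ x = charPoly n (A x)

    χ-charPoly : ∀ x → charPoly n (A x) ≡ χ x
    χ-charPoly x = refl

    coeff-χ : ∀ x i → i ≤ n → coeffℤ (toList (χ x)) i ≡ monomial n i ℤ.- + 2 ℤ.* + D x i
    coeff-χ x i i≤n = trans (coeff-tabulate-< (coeffℤ (detℤ n (charMat n (A x)))) i (s≤s i≤n))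
      (Family.coeff-det m W (e x) (e-support x) i)

  -- Coefficients up to `n` determine `D` there, after cancelling the monomial and the factor -2.
  -- Above `n` both digit sums vanish. Uniqueness of base-W digits then gives equal digits.
  χ-injective : ∀ x y → χ x ≡ χ y → x ≗ y
  χ-injective x y eq = e-injective x y (digitSum-injective W (e x) (e y) (e-< x) (e-< y) m D≗)
    where
    open ≡-Reasoning
    D≗ : D x ≗ D y
    D≗ i with ℕ.<-≤-connex n i
    ... | inj₁ n<i = trans (digitSum-support W (e x) m (e-support x) m i le) (sym (digitSum-support W (e y) m (e-support y) m i le))
      where le = ℕ.<⇒≤ (ℕ.<-trans (ℕ.n<1+n _) n<i)
    ... | inj₂ i≤n = ℤ.+-injective (ℤ.*-cancelˡ-≡ (+ 2) _ _ (ℤ.neg-injective (AbelianGroupProperties.∙-cancelˡ ℤ.+-0-abelianGroup (monomial n i) (ℤ.- (+ 2 ℤ.* + D x i)) (ℤ.- (+ 2 ℤ.* + D y i)) (begin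
      monomial n i ℤ.- + 2 ℤ.* + D x i  ≡⟨ coeff-χ x i i≤n ⟨
      coeffℤ (toList (χ x)) i           ≡⟨ cong (λ v → coeffℤ (toList v) i) eq ⟩
      coeffℤ (toList (χ y)) i           ≡⟨ coeff-χ y i i≤n ⟩
      monomial n i ℤ.- + 2 ℤ.* + D y i  ∎))))

  inBox : ∀ {H} → W ≤ H → ∀ x → InBox n H (A x)
  inBox {H} W≤H x i j = entry-≤ (toℕ i) (toℕ j)
    where
    weight-≤ : ∀ t → weight W t ≤ H
    weight-≤ zero          = ℕ.≤-trans (ℕ.<⇒≤ 1<W) W≤H
    weight-≤ (suc zero)    = ℕ.≤-trans 1<W W≤H
    weight-≤ (suc (suc _)) = W≤H
    entry-≤ : ∀ p k → entry m W (e x) p k ≤ H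
    entry-≤ p k with k ℕ.≟ suc p | k ℕ.<? m | m ℕ.≤? p
    ... | yes _ | _     | _     = weight-≤ (m ∸ p)
    ... | no  _ | yes _ | yes _ = ℕ.≤-trans (ℕ.<⇒≤ (e-< x (m ∸ suc k) (m ℕ.+ m ∸ p))) W≤H
    ... | no  _ | yes _ | no _  = z≤n
    ... | no  _ | no _  | _     = z≤n

  irreducible : ¬ (2 ℕ.∣ W) → ∀ x → IrreducibleQ (toℚPoly (χ x))
  irreducible 2∤W x = eisenstein at-2 (s≤s z≤n) (toℚPoly (χ x)) (coeff-map-ι (toList (χ x)))
    where
    prime-2 : Prime 2
    prime-2 = from-yes (prime? 2)
    f : ℕ → ℤ
    f = coeffℤ (toList (χ x))
    2∣2D : ∀ i → + 2 ∣ ℤ.- (+ 2 ℤ.* + D x i)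
    2∣2D i = ∣m⇒∣-m (∣m⇒∣m*n (+ D x i) (divides (+ 1) refl))
    -- In coefficient 0 the shifted part of the digit sum is zero, so only the top digit remains,
    -- and that is the fixed corner digit 1.
    D₀≡ : D x 0 ≡ W ^ m′
    D₀≡ = trans (cong (_* W ^ m′) (e-fixed x)) (ℕ.*-identityˡ _)
    2∤D₀ : ¬ (2 ℕ.∣ D x 0)
    2∤D₀ h = 2∤W (prime-∣^ prime-2 W m′ (subst (2 ℕ.∣_) D₀≡ h))
    f₀≡ : f 0 ≡ + 2 ℤ.* (ℤ.- + D x 0)
    f₀≡ = trans (coeff-χ x 0 z≤n) (trans (ℤ.+-identityˡ _) (ℤ.neg-distribʳ-* (+ 2) (+ D x 0)))
    at-2 : EisensteinAt 2 n f
    at-2 = record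
      { isPrime = prime-2
      ; top∤    = λ 2∣fn → contradiction (∣⇒∣ᵤ (subst (+ 2 ∣_) (monomial-diag n)
                    (∣m+n∣n⇒∣m {m = monomial n n} (subst (+ 2 ∣_) (coeff-χ x n ℕ.≤-refl) 2∣fn) (2∣2D n))))
                    (ℕ.>⇒∤ (s≤s (s≤s z≤n)))
      ; lower∣  = λ i i<n → subst (+ 2 ∣_) (sym (trans (coeff-χ x i (ℕ.<⇒≤ i<n))
                    (trans (cong (ℤ._- + 2 ℤ.* + D x i) (monomial-off n i (ℕ.<⇒≢ i<n))) (ℤ.+-identityˡ _)))) (2∣2D i)
      ; const∤² = λ h → 2∤D₀ (subst (2 ℕ.∣_) (ℤ.∣-i∣≡∣i∣ (+ D x 0))
                    (∣⇒∣ᵤ (*-cancelˡ-∣ (+ 2) {+ 2} {ℤ.- + D x 0} (subst (+ 2 ℤ.* + 2 ∣_) f₀≡ h))))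
      ; above≡0 = λ i n<i → coeff-toList-≥ (χ x) i n<i
      }

  -- Each choice of free digits is sent to the position of its polynomial in `L`. Looking up the
  -- position returns the polynomial, so the map is injective by `χ-injective`.
  count : ∀ {H} → W ≤ H → ¬ (2 ℕ.∣ W) → ∀ L → Enumerates-I n H L → W ^ freeDigits ≤ length L
  count {H} W≤H 2∤W L (_ , L⇔) = Fin.injective⇒≤ {f = position} position-injective
    where
    x : Fin (W ^ freeDigits) → Fin freeDigits → Fin W
    x = Fin.finToFun
    member : ∀ k → χ (x k) ∈ L
    member k = Equivalence.from (L⇔ _) (irreducible 2∤W (x k) , A (x k) , inBox W≤H (x k) , χ-charPoly (x k))
    position : Fin (W ^ freeDigits) → Fin (length L)
    position k = Any.index (member k)
    position-injective : Injective _≡_ _≡_ position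
    position-injective {k} {l} eq = begin
      k                             ≡⟨ Fin.funToFin-finToFin {freeDigits} {W} k ⟨
      Fin.funToFin (x k)            ≡⟨ funToFin-cong (χ-injective (x k) (x l) (begin
        χ (x k)                     ≡⟨ lookup-index (member k) ⟩
        List.lookup L (position k)  ≡⟨ cong (List.lookup L) eq ⟩
        List.lookup L (position l)  ≡⟨ lookup-index (member l) ⟨
        χ (x l)                     ∎)) ⟩
      Fin.funToFin (x l)  ≡⟨ Fin.funToFin-finToFin {freeDigits} {W} l ⟩
      l                   ∎
      where
      open ≡-Reasoning

-- Comparison of powers of H and W

-- A form of Bernoulli's inequality without division: (1 + 1/W)^j (1 - j/W) ≤ 1, with `d` standing
-- for W - j. The inductive step is (W + 1) d ≤ W (d + 1), valid since d ≤ W.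
bernoulli : ∀ W j d → d ℕ.+ j ≡ W → suc W ^ j * d ≤ W ^ j * W
bernoulli W zero    d d+j≡W = ℕ.*-monoʳ-≤ 1 (ℕ.m+n≤o⇒m≤o d (ℕ.≤-reflexive d+j≡W))
bernoulli W (suc j) d d+j≡W = begin
  suc W * suc W ^ j * d      ≡⟨ solve 3 (λ x y z → x :* y :* z := y :* (x :* z)) refl (suc W) (suc W ^ j) d ⟩
  suc W ^ j * (suc W * d)    ≤⟨ ℕ.*-monoʳ-≤ (suc W ^ j) (ℕ.+-monoˡ-≤ (W * d) (ℕ.m+n≤o⇒m≤o d (ℕ.≤-reflexive d+j≡W))) ⟩
  suc W ^ j * (W ℕ.+ W * d)  ≡⟨ solve 3 (λ y w d → y :* (w :+ w :* d) := w :* (y :* (con 1 :+ d))) refl (suc W ^ j) W d ⟩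
  W * (suc W ^ j * suc d)    ≤⟨ ℕ.*-monoʳ-≤ W (bernoulli W j (suc d) (trans (sym (ℕ.+-suc d j)) d+j≡W)) ⟩
  W * (W ^ j * W)            ≡⟨ ℕ.*-assoc W (W ^ j) W ⟨
  W * W ^ j * W              ∎
  where
  open ℕ.≤-Reasoning
  open ℕ-Solver.+-*-Solver

-- Take `d = W − m` in `bernoulli`: since `m ≤ d`, W is at most 2d, and `d` cancels.
[1+W]^m≤2W^m : ∀ W m → 0 < m → m ℕ.+ m ≤ W → suc W ^ m ≤ W ^ m * 2
[1+W]^m≤2W^m W m 0<m 2m≤W = ℕ.*-cancelʳ-≤ _ _ d (begin
  suc W ^ m * d      ≤⟨ bernoulli W m d (ℕ.m∸n+n≡m (ℕ.m+n≤o⇒m≤o m 2m≤W)) ⟩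
  W ^ m * W          ≡⟨ cong (W ^ m *_) (ℕ.m∸n+n≡m (ℕ.m+n≤o⇒m≤o m 2m≤W)) ⟨
  W ^ m * (d ℕ.+ m)  ≤⟨ ℕ.*-monoʳ-≤ (W ^ m) (ℕ.+-monoʳ-≤ d m≤d) ⟩
  W ^ m * (d ℕ.+ d)  ≡⟨ solve 2 (λ x d → x :* (d :+ d) := x :* con 2 :* d) refl (W ^ m) d ⟩
  W ^ m * 2 * d      ∎)
  where
  open ℕ.≤-Reasoning
  open ℕ-Solver.+-*-Solver
  d = W ∸ m
  m≤d : m ≤ d
  m≤d = ℕ.m+n≤o⇒m≤o∸n m 2m≤W
  instance
    d≢0 : NonZero d
    d≢0 = ℕ.>-nonZero (ℕ.≤-trans 0<m m≤d)

^-distribʳ-* : ∀ x y t → (x * y) ^ t ≡ x ^ t * y ^ t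
^-distribʳ-* x y zero    = refl
^-distribʳ-* x y (suc t) = trans (cong (x * y *_) (^-distribʳ-* x y t))
  (solve 4 (λ x y u v → x :* y :* (u :* v) := x :* u :* (y :* v)) refl x y (x ^ t) (y ^ t))
  where open ℕ-Solver.+-*-Solver

-- Replacing H by W costs at most a factor 2 for each of the `m` blocks of `m` factors. The number
-- of free digits exceeds m² by `m′`, and the surplus W^m′ absorbs 2^m.
H^m²≤W^free : ∀ H W m′ → 1 ≤ m′ → H ≤ suc W → suc m′ ℕ.+ suc m′ ≤ W →
  H ^ (suc m′ * suc m′) ≤ W ^ (suc m′ ℕ.+ m′ * suc (suc m′))
H^m²≤W^free H W m′ 1≤m′ H≤1+W 2m≤W = begin
  H ^ (m * m)             ≤⟨ ℕ.^-monoˡ-≤ (m * m) H≤1+W ⟩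
  suc W ^ (m * m)         ≡⟨ ℕ.^-*-assoc (suc W) m m ⟨
  (suc W ^ m) ^ m         ≤⟨ ℕ.^-monoˡ-≤ m ([1+W]^m≤2W^m W m (s≤s z≤n) 2m≤W) ⟩
  (W ^ m * 2) ^ m         ≡⟨ ^-distribʳ-* (W ^ m) 2 m ⟩
  (W ^ m) ^ m * 2 ^ m     ≡⟨ cong (_* 2 ^ m) (ℕ.^-*-assoc W m m) ⟩
  W ^ (m * m) * 2 ^ m     ≤⟨ ℕ.*-monoʳ-≤ (W ^ (m * m)) 2^m≤W^m′ ⟩
  W ^ (m * m) * W ^ m′    ≡⟨ ℕ.^-distribˡ-+-* W (m * m) m′ ⟨
  W ^ (m * m ℕ.+ m′)      ≡⟨ cong (W ^_) (solve 1 (λ x → (con 1 :+ x) :* (con 1 :+ x) :+ x := (con 1 :+ x) :+ x :* (con 2 :+ x)) refl m′) ⟩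
  W ^ (m ℕ.+ m′ * suc m)  ∎
  where
  open ℕ.≤-Reasoning
  open ℕ-Solver.+-*-Solver
  m = suc m′
  2^m≤W^m′ : 2 ^ m ≤ W ^ m′
  2^m≤W^m′ = begin
    -- Here m ≤ 2m′ because m′ ≥ 1, and 4 ≤ 2m ≤ W.
    2 ^ m            ≤⟨ ℕ.^-monoʳ-≤ 2 (ℕ.+-monoˡ-≤ m′ 1≤m′) ⟩
    2 ^ (m′ ℕ.+ m′)  ≡⟨ ℕ.^-distribˡ-+-* 2 m′ m′ ⟩
    2 ^ m′ * 2 ^ m′  ≡⟨ ^-distribʳ-* 2 2 m′ ⟨
    4 ^ m′           ≤⟨ ℕ.^-monoˡ-≤ m′ (ℕ.≤-trans (ℕ.+-mono-≤ (s≤s 1≤m′) (s≤s 1≤m′)) 2m≤W) ⟩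
    W ^ m′           ∎

odd-below : ∀ H → 1 ≤ H → ∃ λ W → W ≤ H × H ≤ suc W × ¬ (2 ℕ.∣ W)
odd-below (suc W) _ with 2 ℕ.∣? suc W
... | no  2∤H = suc W , ℕ.≤-refl , ℕ.n≤1+n _ , 2∤H
... | yes 2∣H = W , ℕ.n≤1+n _ , ℕ.≤-refl , λ 2∣W →
  ℕ.>⇒∤ (s≤s (s≤s z≤n)) (ℕ.∣m+n∣m⇒∣n (subst (2 ℕ.∣_) (ℕ.+-comm 1 W) 2∣H) 2∣W)

-- The two ranges of H and the final bound

large-H : ∀ m H L → 5 ≤ m → suc (m ℕ.+ m) < H → Enumerates-I (suc (m ℕ.+ m)) H L → H ^ (m * m) ≤ length L
large-H (suc m′) H L (s≤s 4≤m′) n<H enum with odd-below H (ℕ.≤-trans (s≤s z≤n) n<H)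
... | W , W≤H , H≤1+W , 2∤W = ℕ.≤-trans
  (H^m²≤W^free H W m′ (ℕ.≤-trans (s≤s z≤n) 4≤m′) H≤1+W (ℕ.<⇒≤ n≤W))
  (Digits.count m′ W (ℕ.≤-trans (s≤s (s≤s z≤n)) n≤W) W≤H 2∤W L enum)
  where
  n≤W : suc (suc m′ ℕ.+ suc m′) ≤ W
  n≤W = ℕ.≤-pred (ℕ.≤-trans n<H H≤1+W)

-- For `H ≤ n` the error term already outweighs the main term: the subtracted count is dropped and
-- H^(n - 9) is bounded by n^(n - 5).
small-H : ∀ n H a l → H ≤ n → 1 ≤ n →
  (H ^ a ∸ n * l) ^ (n ∸ 5) * H ^ (n ∸ 9) ≤ (n * 1) ^ (n ∸ 5) * H ^ (a * (n ∸ 5))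
small-H n H a l H≤n 1≤n = begin
  (H ^ a ∸ n * l) ^ (n ∸ 5) * H ^ (n ∸ 9)
    ≤⟨ ℕ.*-mono-≤ (ℕ.^-monoˡ-≤ (n ∸ 5) (ℕ.m∸n≤m (H ^ a) (n * l))) (ℕ.^-monoˡ-≤ (n ∸ 9) H≤n) ⟩
  (H ^ a) ^ (n ∸ 5) * n ^ (n ∸ 9)
    ≤⟨ ℕ.*-mono-≤ (ℕ.≤-reflexive (ℕ.^-*-assoc H a (n ∸ 5))) (ℕ.^-monoʳ-≤ n (ℕ.∸-monoʳ-≤ n (ℕ.m≤n+m 5 4))) ⟩
  H ^ (a * (n ∸ 5)) * n ^ (n ∸ 5)
    ≡⟨ ℕ.*-comm (H ^ (a * (n ∸ 5))) (n ^ (n ∸ 5)) ⟩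
  n ^ (n ∸ 5) * H ^ (a * (n ∸ 5))
    ≡⟨ cong (λ x → x ^ (n ∸ 5) * H ^ (a * (n ∸ 5))) (ℕ.*-identityʳ n) ⟨
  (n * 1) ^ (n ∸ 5) * H ^ (a * (n ∸ 5)) ∎
  where
  open ℕ.≤-Reasoning
  instance
    n≢0 : NonZero n
    n≢0 = ℕ.>-nonZero 1≤n

large-H-bound : ∀ n m H → n ≡ suc (m ℕ.+ m) → 11 ≤ n → n < H →
  (L : List (Vec ℤ (suc n))) → Enumerates-I n H L →
  let a = ((n ∸ 1) * (n ∸ 1)) / 4 in
  (H ^ a ∸ n * length L) ^ (n ∸ 5) * H ^ (n ∸ 9) ≡ 0
large-H-bound n m H refl 11≤n n<H L enum = begin
  (H ^ a ∸ n * length L) ^ (n ∸ 5) * H ^ (n ∸ 9)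
    ≡⟨ cong (λ x → x ^ (n ∸ 5) * H ^ (n ∸ 9)) (ℕ.m≤n⇒m∸n≡0 H^a≤n*L) ⟩
  0 ^ (n ∸ 5) * H ^ (n ∸ 9)
    -- Positivity of the exponent n - 5 matters, since `0 ^ 0` is 1.
    ≡⟨ cong (_* H ^ (n ∸ 9)) (0^ (ℕ.m<n⇒0<n∸m (ℕ.≤-trans (ℕ.m≤n+m 6 5) 11≤n))) ⟩
  0 ∎
  where
  open ≡-Reasoning
  a = (m ℕ.+ m) * (m ℕ.+ m) / 4
  0^ : ∀ {k} → 0 < k → 0 ^ k ≡ 0
  0^ {suc k} _ = refl
  5≤m : 5 ≤ m
  5≤m with ℕ.<-≤-connex m 5
  ... | inj₂ 5≤m       = 5≤m
  ... | inj₁ (s≤s m≤4) = contradiction (ℕ.≤-trans 11≤n (s≤s (ℕ.+-mono-≤ m≤4 m≤4))) (ℕ.<⇒≱ (ℕ.m≤n+m 10 1))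
  a≡m² : a ≡ m * m
  a≡m² = trans (cong (_/ 4) (solve 1 (λ x → (x :+ x) :* (x :+ x) := x :* x :* con 4) refl m)) (ℕ.m*n/n≡m (m * m) 4)
    where open ℕ-Solver.+-*-Solver
  H^a≤n*L : H ^ a ≤ n * length L
  H^a≤n*L = ℕ.≤-trans (ℕ.≤-reflexive (cong (H ^_) a≡m²))
    (ℕ.≤-trans (large-H m H L 5≤m n<H enum) (ℕ.m≤n*m (length L) n))

-- The inequality is multiplied by n, rearranged and raised to the power n - 5, which clears the
-- fractional exponent (n - 9)/(n - 5). Truncated subtraction covers the case in which n times the
-- count exceeds H^a, and the division by 4 is exact because n is odd.
theorem1p1 : Σ ℕ (λ C → 0 < C ×
    ((n H : ℕ) → n % 2 ≡ 1 → 11 ≤ n → 1 ≤ H →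
    (L : List (Vec ℤ (suc n))) → Enumerates-I n H L →
    let a = ((n ∸ 1) * (n ∸ 1)) / 4 in
    (H ^ a ∸ n * length L) ^ (n ∸ 5) * H ^ (n ∸ 9)
    ≤ (n * C) ^ (n ∸ 5) * H ^ (a * (n ∸ 5))))
theorem1p1 = 1 , s≤s z≤n , bound
  where
  bound : (n H : ℕ) → n % 2 ≡ 1 → 11 ≤ n → 1 ≤ H →
    (L : List (Vec ℤ (suc n))) → Enumerates-I n H L →
    let a = ((n ∸ 1) * (n ∸ 1)) / 4 in
    (H ^ a ∸ n * length L) ^ (n ∸ 5) * H ^ (n ∸ 9)
    ≤ (n * 1) ^ (n ∸ 5) * H ^ (a * (n ∸ 5))
  bound n H n-odd 11≤n 1≤H L enum with ℕ.≤-<-connex H n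
  ... | inj₁ H≤n = small-H n H (((n ∸ 1) * (n ∸ 1)) / 4) (length L) H≤n (ℕ.≤-trans (s≤s z≤n) 11≤n)
  ... | inj₂ n<H = ℕ.≤-trans (ℕ.≤-reflexive (large-H-bound n (n / 2) H n≡1+2m 11≤n n<H L enum)) z≤n
    where
    n≡1+2m : n ≡ suc (n / 2 ℕ.+ n / 2)
    n≡1+2m = trans (ℕ.m≡m%n+[m/n]*n n 2) (cong₂ ℕ._+_ n-odd
      (trans (ℕ.*-comm (n / 2) 2) (cong (n / 2 ℕ.+_) (ℕ.+-identityʳ (n / 2)))))
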